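{- Let $p$ be a prime and $q$ a power of $p$. Let $r,s$ be positive integers with $r,s,p$ pairwise relatively prime, let $d\ge1$ be an integer prime to $p$, and let $X$ be the smooth projective curve over $\mathbb{F}_q(t)$ associated to $$y^r=\frac{(x^s+1)(x^s+t^{ds})}{x^s}.$$ Let $g=(r-1)s$ (the genus of $X$) and suppose $g>2$. Let $(x,y)$ be an $\mathbb{F}_q(t)$-rational point on $X$, write $x=u/v$ with $u,v\in\mathbb{F}_q[t]$ and $\gcd(u,v)=1$, and let $\delta=\max\{\deg u,\deg v\}$. If $x$ is not a $p$-th power in $\mathbb{F}_q(t)$, then $$\delta\le\frac{dg-1}{g-2},$$ and if $x$ is a $p$-th power in $\mathbb{F}_q(t)$, then $$\delta\le\frac{2d(g-1)-1}{g-2}.$$ -}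

module Defs where

open import Level using (Level; 0ℓ; _⊔_)
open import Data.Nat using (ℕ; zero; suc; _∸_; _<_)
open import Data.Fin using (Fin)
open import Data.Product using (Σ; _×_; ∃)
open import Relation.Nullary using (¬_)
open import Relation.Binary.PropositionalEquality as ≡ using (_≡_)
open import Function.Bundles using (Bijection)
open import Algebra.Bundles using (CommutativeRing)

-- Polynomials over a commutative ring R, in one variable t, represented by
-- their coefficient sequence  ℕ → Carrier  together with the predicate
-- IsPoly (all but finitely many coefficients vanish).  Equality is
-- coefficientwise (setoid) equality.
module Poly {c ℓ : Level} (R : CommutativeRing c ℓ) where
  open CommutativeRing R public using (Carrier; _≈_; 0#; 1#; setoid)
  open CommutativeRing R using (_+_; _*_)

  Seq : Set c
  Seq = ℕ → Carrier

  IsPoly : Seq → Set ℓ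
  IsPoly f = ∃ λ N → ∀ n → N Data.Nat.≤ n → f n ≈ 0#

  infix 4 _≈ₚ_
  _≈ₚ_ : Seq → Seq → Set ℓ
  f ≈ₚ g = ∀ n → f n ≈ g n

  0ₚ : Seq
  0ₚ _ = 0#

  1ₚ : Seq
  1ₚ zero    = 1#
  1ₚ (suc _) = 0#

  tpow : ℕ → Seq
  tpow zero    zero    = 1#
  tpow zero    (suc _) = 0#
  tpow (suc k) zero    = 0#
  tpow (suc k) (suc n) = tpow k n

  infixl 6 _+ₚ_
  _+ₚ_ : Seq → Seq → Seq
  (f +ₚ g) n = f n + g n

  Σ≤ : (ℕ → Carrier) → ℕ → Carrier
  Σ≤ h zero    = h zero
  Σ≤ h (suc n) = Σ≤ h n + h (suc n)

  infixl 7 _*ₚ_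
  _*ₚ_ : Seq → Seq → Seq
  (f *ₚ g) n = Σ≤ (λ i → f i * g (n ∸ i)) n

  infixr 8 _^ₚ_
  _^ₚ_ : Seq → ℕ → Seq
  f ^ₚ zero  = 1ₚ
  f ^ₚ suc k = f *ₚ (f ^ₚ k)

  _∣ₚ_ : Seq → Seq → Set (c ⊔ ℓ)
  g ∣ₚ f = ∃ λ h → IsPoly h × (h *ₚ g ≈ₚ f)

  CoprimeₚTo : Seq → Seq → Set (c ⊔ ℓ)
  CoprimeₚTo u v = ∀ w → IsPoly w → w ∣ₚ u → w ∣ₚ v → w ∣ₚ 1ₚ

  -- deg f ≤ k  (the zero polynomial has degree ≤ every k)
  DegLe : Seq → ℕ → Set ℓ
  DegLe f k = ∀ n → k < n → f n ≈ 0#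

  -- the rational function u/v (v ≠ 0) is a p-th power in R(t):
  -- u/v = (a/b)^p for polynomials a, b with b ≠ 0
  IsPthPowerFrac : ℕ → Seq → Seq → Set (c ⊔ ℓ)
  IsPthPowerFrac p u v =
    ∃ λ a → ∃ λ b → IsPoly a × IsPoly b × ¬ (b ≈ₚ 0ₚ) ×
      (u *ₚ (b ^ₚ p) ≈ₚ v *ₚ (a ^ₚ p))

  ℕ→R : ℕ → Carrier
  ℕ→R zero    = 0#
  ℕ→R (suc n) = 1# + ℕ→R n

  IsField : Set (c ⊔ ℓ)
  IsField = ¬ (1# ≈ 0#) × (∀ x → ¬ (x ≈ 0#) → ∃ λ y → x * y ≈ 1#)

  HasCard : ℕ → Set (c ⊔ ℓ)
  HasCard q = Bijection (≡.setoid (Fin q)) setoid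

module Submission where

-- Put A = uˢ + vˢ, B = uˢ + t^(ds) vˢ and D = t^(ds) − 1, so that B − A = D vˢ
-- and the curve reads wʳ uˢ vˢ = zʳ A B.  Away from the zeros of t D the
-- polynomials u, v, A and B are pairwise coprime, so each of them is there an
-- r-th power up to a unit.
--
-- If the Wronskian W = u′ v − u v′ is nonzero, then at a zero of order m of u, v
-- or A it vanishes to order at least m − 1; since r divides m away from t D, this
-- gives (u v A)^(r−1) ∣ Wʳ (t D)^(r−1), and comparing degrees bounds δ.
-- If x is a p-th power, then u′ = v′ = 0, so t B′ = d s t^(ds) vˢ and B has only
-- simple zeros away from t; these must be zeros of D, so B ∣ t^(ds) D.  As p
-- divides deg u and deg v but not d, the leading terms of B do not cancel, and
-- δ ≤ 2d follows.  Over a finite field, W = 0 forces x to be a p-th power.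

open import Defs
open import Level using (Level; _⊔_)
open import Data.Empty using (⊥-elim)
open import Data.Fin using (Fin; toℕ; fromℕ; inject₁; punchOut)
import Data.Fin.Properties as Fin
open import Data.Nat as ℕ using (ℕ; zero; suc; _∸_; _≤_; _<_; z≤n; s≤s; _≤?_; _!; NonZero)
open import Data.Nat.Combinatorics using (_C_; nCn≡1; nCk≡n!/k![n-k]!; k![n∸k]!∣n!)
open import Data.Nat.Coprimality using (Coprime; coprime-Bézout)
import Data.Nat.Divisibility as ℕ∣
open import Data.Nat.DivMod using (m/n*n≡m)
open import Data.Nat.GCD using (module Bézout)
open import Data.Nat.Primality using (Prime; euclidsLemma; prime⇒irreducible; prime⇒nonTrivial)
import Data.Nat.Properties as ℕ
open import Data.Nat.Solver using (module +-*-Solver)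
open import Data.Product using (_×_; ∃; ∃₂; _,_; proj₁; proj₂)
open import Data.Sum as Sum using (_⊎_; inj₁; inj₂)
open import Function.Bundles using (module Bijection)
open import Relation.Nullary using (¬_; Dec; yes; no)
open import Relation.Binary.PropositionalEquality as ≡ using (_≡_)
open import Algebra.Bundles using (CommutativeRing)

-- The separable bound is a Riemann-Hurwitz count for x, viewed as a map from the t-line, with
-- ramification forced over constant values of x: 0, infinity and the roots of x^s = -1, which give
-- the zeros of u, v and A. The zeros of B lie over the moving values x^s = -t^(ds), where dx need
-- not vanish; B carries the argument only when dx = 0, for then just its factor t^(ds) is
-- differentiated. If r divides m > 0, then m - 1 is at least m(r-1)/r; hence the exponents r-1 and
-- r in the divisibility. At a zero of t D the order m is unconstrained, and (t D)^(r-1) makes up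
-- for it. The point t = infinity is handled by degrees: v A' - s v' A = s u^(s-1) W bounds deg W
-- through deg A. In the combined inequality deg A survives only through its upper bound s δ, so
-- cancellation in A does no harm. What remains is δ g < 2 δ + d g. Nothing is factored into primes:
-- orders of vanishing are expressed by divisibility between comaximal elements, and gcds split off
-- the part of a polynomial supported at t D.

module Multiples {c ℓ : Level} (R : CommutativeRing c ℓ) where

  open CommutativeRing R
  open import Algebra.Properties.Semiring.Mult semiring renaming (_×_ to _×ℕ_) using (×-congʳ; ×-assoc-*)

  ×-as-* : ∀ n x → n ×ℕ x ≈ n ×ℕ 1# * x
  ×-as-* n x = trans (×-congʳ n (sym (*-identityˡ x))) (sym (×-assoc-* n 1# x))

  ×-zeroʳ : ∀ n → n ×ℕ 0# ≈ 0#
  ×-zeroʳ n = trans (×-as-* n 0#) (zeroʳ _)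

-- Comaximal elements of a commutative ring.

module Comaximality {c ℓ : Level} (R : CommutativeRing c ℓ) where

  open CommutativeRing R
  open import Algebra.Properties.CommutativeSemiring.Exp commutativeSemiring using (_^_)
  open import Algebra.Properties.Semiring.Divisibility semiring using (_∣_; _,_; ∣-respʳ)
  open import Algebra.Solver.Ring.NaturalCoefficients.Default commutativeSemiring
    using (solve; _:+_; _:*_; _:=_)
  open import Relation.Binary.Reasoning.Setoid setoid

  infix 4 _⊥_

  -- Coprimality is taken with its coefficients: every fact below is then an explicit identity,
  -- valid in any commutative ring.
  _⊥_ : Carrier → Carrier → Set (c ⊔ ℓ)
  a ⊥ b = ∃₂ λ x y → x * a + y * b ≈ 1#

  ⊥-sym : ∀ {a b} → a ⊥ b → b ⊥ a
  ⊥-sym (x , y , eq) = y , x , trans (+-comm _ _) eq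

  ⊥-∣ˡ : ∀ {a b d} → d ∣ a → a ⊥ b → d ⊥ b
  ⊥-∣ˡ (q , eq) (x , y , one) =
    x * q , y , trans (+-congʳ (trans (*-assoc _ _ _) (*-congˡ eq))) one

  ⊥-∣ʳ : ∀ {a b d} → d ∣ b → a ⊥ b → a ⊥ d
  ⊥-∣ʳ d∣b a⊥b = ⊥-sym (⊥-∣ˡ d∣b (⊥-sym a⊥b))

  ∣1⇒⊥ : ∀ {a b} → b ∣ 1# → a ⊥ b
  ∣1⇒⊥ (q , eq) = 0# , q , trans (+-cong (zeroˡ _) eq) (+-identityˡ _)

  ⊥-*ʳ : ∀ {a b c} → a ⊥ b → a ⊥ c → a ⊥ b * c
  ⊥-*ʳ {a} {b} {c} (x , y , eq) (x′ , y′ , eq′) =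
    x * x′ * a + x * (y′ * c) + y * b * x′ , y * y′ , (begin
      (x * x′ * a + x * (y′ * c) + y * b * x′) * a + y * y′ * (b * c)
        ≈⟨ solve 7 (λ a b c x y x′ y′ →
             (x :* x′ :* a :+ x :* (y′ :* c) :+ y :* b :* x′) :* a :+ y :* y′ :* (b :* c)
             := (x :* a :+ y :* b) :* (x′ :* a :+ y′ :* c)) refl a b c x y x′ y′ ⟩
      (x * a + y * b) * (x′ * a + y′ * c)  ≈⟨ *-cong eq eq′ ⟩
      1# * 1#                              ≈⟨ *-identityˡ 1# ⟩
      1#                                   ∎)

  ⊥-^ʳ : ∀ {a b} n → a ⊥ b → a ⊥ b ^ n
  ⊥-^ʳ zero    a⊥b = ∣1⇒⊥ (1# , *-identityˡ _)
  ⊥-^ʳ (suc n) a⊥b = ⊥-*ʳ a⊥b (⊥-^ʳ n a⊥b)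

  ⊥-*ˡ : ∀ {a b c} → a ⊥ c → b ⊥ c → a * b ⊥ c
  ⊥-*ˡ a⊥c b⊥c = ⊥-sym (⊥-*ʳ (⊥-sym a⊥c) (⊥-sym b⊥c))

  ⊥-^ˡ : ∀ {a b} n → a ⊥ b → a ^ n ⊥ b
  ⊥-^ˡ n a⊥b = ⊥-sym (⊥-^ʳ n (⊥-sym a⊥b))

  ⊥-gauss : ∀ {a b c} → a ⊥ b → a ∣ b * c → a ∣ c
  ⊥-gauss {a} {b} {c} (x , y , eq) (q , qa≈bc) = x * c + y * q , (begin
    (x * c + y * q) * a
      ≈⟨ solve 5 (λ a c x y q → (x :* c :+ y :* q) :* a
           := x :* a :* c :+ y :* (q :* a)) refl a c x y q ⟩
    x * a * c + y * (q * a)  ≈⟨ +-congˡ (*-congˡ qa≈bc) ⟩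
    x * a * c + y * (b * c)
      ≈⟨ solve 5 (λ a b c x y → x :* a :* c :+ y :* (b :* c)
           := (x :* a :+ y :* b) :* c) refl a b c x y ⟩
    (x * a + y * b) * c      ≈⟨ *-congʳ eq ⟩
    1# * c                   ≈⟨ *-identityˡ c ⟩
    c                        ∎)

  ⊥-*-∣ : ∀ {a b c} → a ⊥ b → a ∣ c → b ∣ c → a * b ∣ c
  ⊥-*-∣ {a} {b} {c} (x , y , eq) (q , qa≈c) (q′ , q′b≈c) = x * q′ + y * q , (begin
    (x * q′ + y * q) * (a * b)
      ≈⟨ solve 6 (λ a b x y q q′ → (x :* q′ :+ y :* q) :* (a :* b)
           := x :* a :* (q′ :* b) :+ y :* b :* (q :* a)) refl a b x y q q′ ⟩
    x * a * (q′ * b) + y * b * (q * a)   ≈⟨ +-cong (*-congˡ q′b≈c) (*-congˡ qa≈c) ⟩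
    x * a * c + y * b * c                ≈⟨ distribʳ c (x * a) (y * b) ⟨
    (x * a + y * b) * c                  ≈⟨ *-congʳ eq ⟩
    1# * c                               ≈⟨ *-identityˡ c ⟩
    c                                    ∎)

  -- Modulo `a` the elements `b` and `e` agree. In this way coprimality of `u` and `v` passes to the
  -- sums `A` and `B`.
  ⊥-sumʳ : ∀ {a b c e} → a ⊥ b → a ∣ c → c + b ≈ e → a ⊥ e
  ⊥-sumʳ {a} {b} {c} {e} (x , y , eq) (q , qa≈c) c+b≈e = x + - (y * q) , y , (begin
    (x + - (y * q)) * a + y * e                 ≈⟨ +-congˡ (*-congˡ (trans (sym c+b≈e) (+-congʳ (sym qa≈c)))) ⟩
    (x + - (y * q)) * a + y * (q * a + b)
      ≈⟨ solve 6 (λ a b x y q m → (x :+ m) :* a :+ y :* (q :* a :+ b)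
           := (y :* q :+ m) :* a :+ (x :* a :+ y :* b)) refl a b x y q (- (y * q)) ⟩
    (y * q + - (y * q)) * a + (x * a + y * b)   ≈⟨ +-cong (*-congʳ (-‿inverseʳ _)) eq ⟩
    0# * a + 1#                                 ≈⟨ +-congʳ (zeroˡ a) ⟩
    0# + 1#                                     ≈⟨ +-identityˡ 1# ⟩
    1#                                          ∎)

  ∣-+ : ∀ {a b c} → a ∣ b → a ∣ c → a ∣ b + c
  ∣-+ {a} (q , qa≈b) (q′ , q′a≈c) = q + q′ , trans (distribʳ a q q′) (+-cong qa≈b q′a≈c)

  ∣-cancel-+ˡ : ∀ {a b c} → a ∣ b → a ∣ b + c → a ∣ c
  ∣-cancel-+ˡ {a} {b} {c} (q , qa≈b) a∣b+c =
    ∣-respʳ (begin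
      - q * a + (b + c)  ≈⟨ +-assoc _ _ _ ⟨
      - q * a + b + c    ≈⟨ +-congʳ (+-congˡ qa≈b) ⟨
      - q * a + q * a + c ≈⟨ +-congʳ (distribʳ a (- q) q) ⟨
      (- q + q) * a + c  ≈⟨ +-congʳ (trans (*-congʳ (-‿inverseˡ q)) (zeroˡ a)) ⟩
      0# + c             ≈⟨ +-identityˡ c ⟩
      c                  ∎)
      (∣-+ (- q , refl) a∣b+c)

  ∣-^ : ∀ {a b} n → a ∣ b → a ^ n ∣ b ^ n
  ∣-^ zero    _ = 1# , *-identityˡ 1#
  ∣-^ {a} {b} (suc n) a∣b@(q , eq) with ∣-^ n a∣b
  ... | q′ , eq′ = q * q′ , trans
    (solve 4 (λ q q′ a x → q :* q′ :* (a :* x) := q :* a :* (q′ :* x)) refl q q′ a (a ^ n))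
    (*-cong eq eq′)

-- Bézout domains and the extraction of r-th powers.

module _ {c ℓ : Level} (R : CommutativeRing c ℓ) where
  open CommutativeRing R
  open import Algebra.Properties.Semiring.Divisibility semiring using (_∣_)

  record IsBézoutDomain : Set (c ⊔ ℓ) where
    field
      *-cancelˡ : ∀ {a b c} → ¬ (a ≈ 0#) → a * b ≈ a * c → b ≈ c
      1≉0       : ¬ (1# ≈ 0#)
      bézout    : ∀ a b → ∃ λ g → g ∣ a × g ∣ b × ∃₂ λ x y → x * a + y * b ≈ g

module PowerPart {c ℓ : Level} (R : CommutativeRing c ℓ) (isBézoutDomain : IsBézoutDomain R) where

  open CommutativeRing R
  open IsBézoutDomain isBézoutDomain
  open Comaximality R
  open import Algebra.Properties.CommutativeSemiring.Exp commutativeSemiring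
    using (_^_; ^-congˡ; ^-congʳ; ^-assocʳ; ^-distrib-*)
  open import Algebra.Properties.Semiring.Divisibility semiring
    using (_∣_; _∥_; _,_; ∣-trans; ∣-respʳ; x∣yx)
  open import Algebra.Properties.CommutativeSemigroup.Divisibility *-commutativeSemigroup
    using (x∣xy)
  open import Algebra.Solver.Ring.NaturalCoefficients.Default commutativeSemiring
    using (solve; _:+_; _:*_; _:=_)
  open import Relation.Binary.Reasoning.Setoid setoid

  *-cancelʳ : ∀ {a b c} → ¬ (a ≈ 0#) → b * a ≈ c * a → b ≈ c
  *-cancelʳ a≉0 eq = *-cancelˡ a≉0 (trans (*-comm _ _) (trans eq (*-comm _ _)))

  *-≉0 : ∀ {a b} → ¬ (a ≈ 0#) → ¬ (b ≈ 0#) → ¬ (a * b ≈ 0#)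
  *-≉0 a≉0 b≉0 ab≈0 = b≉0 (*-cancelˡ a≉0 (trans ab≈0 (sym (zeroʳ _))))

  ^-≉0 : ∀ {a} n → ¬ (a ≈ 0#) → ¬ (a ^ n ≈ 0#)
  ^-≉0 zero    a≉0 = 1≉0
  ^-≉0 (suc n) a≉0 = *-≉0 a≉0 (^-≉0 n a≉0)

  ∣-≉0 : ∀ {a b} → a ∣ b → ¬ (b ≈ 0#) → ¬ (a ≈ 0#)
  ∣-≉0 (q , qa≈b) b≉0 a≈0 = b≉0 (trans (sym qa≈b) (trans (*-congˡ a≈0) (zeroʳ q)))

  ∣^ : ∀ n .{{_ : NonZero n}} {a} → a ∣ a ^ n
  ∣^ (suc n) {a} = x∣xy a (a ^ n)

  reduce : ∀ a b → ¬ (a ≈ 0#) ⊎ ¬ (b ≈ 0#) →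
           ∃ λ g → ∃₂ λ a′ b′ → ¬ (g ≈ 0#) × a′ * g ≈ a × b′ * g ≈ b × a′ ⊥ b′
  reduce a b a⊎b≉0 with bézout a b
  ... | g , g∣a@(a′ , eqa) , g∣b@(b′ , eqb) , x , y , eq =
    g , a′ , b′ , g≉0 a⊎b≉0 , eqa , eqb , x , y , *-cancelʳ (g≉0 a⊎b≉0) (begin
      (x * a′ + y * b′) * g
        ≈⟨ solve 5 (λ x y a b g → (x :* a :+ y :* b) :* g
             := x :* (a :* g) :+ y :* (b :* g)) refl x y a′ b′ g ⟩
      x * (a′ * g) + y * (b′ * g)  ≈⟨ +-cong (*-congˡ eqa) (*-congˡ eqb) ⟩
      x * a + y * b                ≈⟨ eq ⟩
      g                            ≈⟨ *-identityˡ g ⟨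
      1# * g                       ∎)
    where
    g≉0 : ¬ (a ≈ 0#) ⊎ ¬ (b ≈ 0#) → ¬ (g ≈ 0#)
    g≉0 (inj₁ a≉0) = ∣-≉0 g∣a a≉0
    g≉0 (inj₂ b≉0) = ∣-≉0 g∣b b≉0

  -- The root is the gcd `α` of `P` and `y`. The powers `P ^ r` and `y ^ r` generate the ideal of
  -- `α ^ r`, and `P` divides both of them; conversely `α ^ r` divides `N * P` and is coprime to
  -- `N`.
  ⊥-factor-of-power : ∀ r .{{_ : NonZero r}} {P N y} → ¬ (P ≈ 0#) → P ⊥ N → N * P ≈ y ^ r →
                      ∃ λ α → P ∥ α ^ r
  ⊥-factor-of-power r {P} {N} {y} P≉0 P⊥N NP≈yʳ = from-reduced (reduce P y (inj₁ P≉0))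
    where
    P∣αʳ : ∀ {α P′ y′} → P′ * α ≈ P → y′ * α ≈ y → P′ ^ r ⊥ y′ ^ r → P ∣ α ^ r
    P∣αʳ {α} {P′} {y′} P′α≈P y′α≈y (a , b , one) = ∣-respʳ (begin
      a * P ^ r + b * y ^ r
        ≈⟨ +-cong (*-congˡ (^-congˡ r P′α≈P)) (*-congˡ (^-congˡ r y′α≈y)) ⟨
      a * (P′ * α) ^ r + b * (y′ * α) ^ r
        ≈⟨ +-cong (*-congˡ (^-distrib-* P′ α r)) (*-congˡ (^-distrib-* y′ α r)) ⟩
      a * (P′ ^ r * α ^ r) + b * (y′ ^ r * α ^ r)
        ≈⟨ solve 5 (λ a b p y z → a :* (p :* z) :+ b :* (y :* z)
             := (a :* p :+ b :* y) :* z) refl a b (P′ ^ r) (y′ ^ r) (α ^ r) ⟩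
      (a * P′ ^ r + b * y′ ^ r) * α ^ r
        ≈⟨ *-congʳ one ⟩
      1# * α ^ r
        ≈⟨ *-identityˡ _ ⟩
      α ^ r ∎)
      (∣-+ (∣-trans (∣^ r) (x∣yx (P ^ r) a)) (∣-trans (N , NP≈yʳ) (x∣yx (y ^ r) b)))

    from-reduced : (∃ λ g → ∃₂ λ a′ b′ → ¬ (g ≈ 0#) × a′ * g ≈ P × b′ * g ≈ y × a′ ⊥ b′) →
                   ∃ λ α → P ∥ α ^ r
    from-reduced (α , P′ , y′ , α≉0 , P′α≈P , y′α≈y , P′⊥y′) =
      α , P∣αʳ P′α≈P y′α≈y (⊥-^ˡ r (⊥-^ʳ r P′⊥y′)) ,
      ⊥-gauss (⊥-^ˡ r (⊥-∣ˡ (P′ , P′α≈P) P⊥N)) (∣-respʳ (sym NP≈yʳ) (∣-^ r (y′ , y′α≈y)))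

  -- At a zero of `P` neither `M` nor `Q` contributes, so the order of `P` there is a multiple of
  -- `r`. With `x / y` reduced to `x′ / y′`, the power `y′ ^ r` divides `P * M` and is a multiple of
  -- `P`; its cofactor divides `M` and is therefore coprime to `P`. The alternative in the
  -- hypothesis allows `z`, which is nonzero, to stand on either side, while `w` may be zero.
  power-part : ∀ r .{{_ : NonZero r}} {x y P M Q} → ¬ (P ≈ 0#) → ¬ (x ≈ 0#) ⊎ ¬ (y ≈ 0#) →
               P ⊥ M → P ⊥ Q → x ^ r * (P * M) ≈ y ^ r * Q →
               ∃ λ α → P ∥ α ^ r
  power-part r {x} {y} {P} {M} {Q} P≉0 x⊎y≉0 P⊥M P⊥Q eq = from-reduced (reduce x y x⊎y≉0)
    where
    from-quotients : ∀ {x′ y′} → x′ ^ r * (P * M) ≈ y′ ^ r * Q →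
                     y′ ^ r ∣ P * M → P ∣ y′ ^ r → ∃ λ α → P ∥ α ^ r
    from-quotients {x′} {y′} reduced (K , Kyʳ≈PM) (N , NP≈yʳ) =
      ⊥-factor-of-power r P≉0 (⊥-∣ʳ (K , *-cancelʳ P≉0 (begin
        K * N * P      ≈⟨ *-assoc K N P ⟩
        K * (N * P)    ≈⟨ *-congˡ NP≈yʳ ⟩
        K * y′ ^ r     ≈⟨ Kyʳ≈PM ⟩
        P * M          ≈⟨ *-comm P M ⟩
        M * P          ∎)) P⊥M) NP≈yʳ

    from-reduced : (∃ λ g → ∃₂ λ a′ b′ → ¬ (g ≈ 0#) × a′ * g ≈ x × b′ * g ≈ y × a′ ⊥ b′) →
                   ∃ λ α → P ∥ α ^ r
    from-reduced (h , x′ , y′ , h≉0 , x′h≈x , y′h≈y , x′⊥y′) = from-quotients reduced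
      (⊥-gauss (⊥-sym (⊥-^ˡ r (⊥-^ʳ r x′⊥y′))) (∣-respʳ (sym reduced) (x∣xy (y′ ^ r) Q)))
      (⊥-gauss P⊥Q (∣-respʳ (trans reduced (*-comm _ _))
        (∣-trans (x∣xy P M) (x∣yx (P * M) (x′ ^ r)))))
      where
      reduced : x′ ^ r * (P * M) ≈ y′ ^ r * Q
      reduced = *-cancelʳ (^-≉0 r h≉0) (begin
        x′ ^ r * (P * M) * h ^ r
          ≈⟨ solve 3 (λ a b c → a :* b :* c := a :* c :* b) refl (x′ ^ r) (P * M) (h ^ r) ⟩
        x′ ^ r * h ^ r * (P * M)    ≈⟨ *-congʳ (^-distrib-* x′ h r) ⟨
        (x′ * h) ^ r * (P * M)      ≈⟨ *-congʳ (^-congˡ r x′h≈x) ⟩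
        x ^ r * (P * M)             ≈⟨ eq ⟩
        y ^ r * Q                   ≈⟨ *-congʳ (^-congˡ r y′h≈y) ⟨
        (y′ * h) ^ r * Q            ≈⟨ *-congʳ (^-distrib-* y′ h r) ⟩
        y′ ^ r * h ^ r * Q          ≈⟨ solve 3 (λ a b c → a :* b :* c := a :* c :* b) refl (y′ ^ r) (h ^ r) Q ⟩
        y′ ^ r * Q * h ^ r          ∎)

  ^-^-comm : ∀ x m n → (x ^ m) ^ n ≈ (x ^ n) ^ m
  ^-^-comm x m n = begin
    (x ^ m) ^ n    ≈⟨ ^-assocʳ x m n ⟩
    x ^ (m ℕ.* n)  ≈⟨ ^-congʳ x (ℕ.*-comm m n) ⟩
    x ^ (n ℕ.* m)  ≈⟨ ^-assocʳ x n m ⟨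
    (x ^ n) ^ m    ∎

  -- Raising the relation to the a-th power, where a is a Bézout coefficient
  -- with s a ≡ ±1 (mod r), turns the factor Pˢ into P up to an r-th power.
  power-part-^ : ∀ r s .{{_ : NonZero r}} {x y P M Q} → Coprime r s → ¬ (P ≈ 0#) → ¬ (x ≈ 0#) ⊎ ¬ (y ≈ 0#) →
                 P ⊥ M → P ⊥ Q → x ^ r * (P ^ s * M) ≈ y ^ r * Q →
                 ∃ λ α → P ∥ α ^ r
  power-part-^ r s {x} {y} {P} {M} {Q} r⊥s P≉0 x⊎y≉0 P⊥M P⊥Q eq = from-Bézout (coprime-Bézout r⊥s)
    where
    raised : ∀ a → (x ^ a) ^ r * ((P ^ s) ^ a * M ^ a) ≈ (y ^ a) ^ r * Q ^ a
    raised a = begin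
      (x ^ a) ^ r * ((P ^ s) ^ a * M ^ a)  ≈⟨ *-cong (^-^-comm x a r) (sym (^-distrib-* (P ^ s) M a)) ⟩
      (x ^ r) ^ a * (P ^ s * M) ^ a        ≈⟨ ^-distrib-* (x ^ r) (P ^ s * M) a ⟨
      (x ^ r * (P ^ s * M)) ^ a            ≈⟨ ^-congˡ a eq ⟩
      (y ^ r * Q) ^ a                      ≈⟨ ^-distrib-* (y ^ r) Q a ⟩
      (y ^ r) ^ a * Q ^ a                  ≈⟨ *-congʳ (^-^-comm y r a) ⟩
      (y ^ a) ^ r * Q ^ a                  ∎

    P^a*s : ∀ a → P ^ (a ℕ.* s) ≈ (P ^ s) ^ a
    P^a*s a = trans (^-congʳ P (ℕ.*-comm a s)) (sym (^-assocʳ P s a))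

    ≉0-left : ∀ a b → ¬ (x ≈ 0#) ⊎ ¬ (y ≈ 0#) → ¬ (x ^ a * P ^ b ≈ 0#) ⊎ ¬ (y ^ a ≈ 0#)
    ≉0-left a b (inj₁ x≉0) = inj₁ (*-≉0 (^-≉0 a x≉0) (^-≉0 b P≉0))
    ≉0-left a b (inj₂ y≉0) = inj₂ (^-≉0 a y≉0)

    from-Bézout : Bézout.Identity 1 r s → ∃ λ α → P ∥ α ^ r
    -- Here `a * s` is one less than a multiple of `r`: a further factor `P` on both sides completes
    -- the power, and the two sides exchange roles.
    from-Bézout (Bézout.+- b a 1+as≡br) =
      power-part r {y ^ a} {x ^ a * P ^ b} {P} {Q ^ a} {M ^ a} P≉0 (Sum.swap (≉0-left a b x⊎y≉0))
        (⊥-^ʳ a P⊥Q) (⊥-^ʳ a P⊥M) (begin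
        (y ^ a) ^ r * (P * Q ^ a)
          ≈⟨ solve 3 (λ x y z → x :* (y :* z) := y :* (x :* z)) refl ((y ^ a) ^ r) P (Q ^ a) ⟩
        P * ((y ^ a) ^ r * Q ^ a)
          ≈⟨ *-congˡ (raised a) ⟨
        P * ((x ^ a) ^ r * ((P ^ s) ^ a * M ^ a))
          ≈⟨ *-congˡ (*-congˡ (*-congʳ (P^a*s a))) ⟨
        P * ((x ^ a) ^ r * (P ^ (a ℕ.* s) * M ^ a))
          ≈⟨ solve 4 (λ x y z w → x :* (y :* (z :* w))
               := y :* (x :* z) :* w) refl P ((x ^ a) ^ r) (P ^ (a ℕ.* s)) (M ^ a) ⟩
        (x ^ a) ^ r * P ^ (suc (a ℕ.* s)) * M ^ a
          ≈⟨ *-congʳ (*-congˡ (trans (^-congʳ P 1+as≡br) (sym (^-assocʳ P b r)))) ⟩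
        (x ^ a) ^ r * (P ^ b) ^ r * M ^ a
          ≈⟨ *-congʳ (^-distrib-* (x ^ a) (P ^ b) r) ⟨
        (x ^ a * P ^ b) ^ r * M ^ a ∎)
    from-Bézout (Bézout.-+ b a 1+br≡as) =
      power-part r {x ^ a * P ^ b} {y ^ a} {P} {M ^ a} {Q ^ a} P≉0 (≉0-left a b x⊎y≉0)
        (⊥-^ʳ a P⊥M) (⊥-^ʳ a P⊥Q) (begin
        (x ^ a * P ^ b) ^ r * (P * M ^ a)
          ≈⟨ *-congʳ (^-distrib-* (x ^ a) (P ^ b) r) ⟩
        (x ^ a) ^ r * (P ^ b) ^ r * (P * M ^ a)
          ≈⟨ solve 4 (λ x z p w → x :* z :* (p :* w)
               := x :* (p :* z :* w)) refl ((x ^ a) ^ r) ((P ^ b) ^ r) P (M ^ a) ⟩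
        (x ^ a) ^ r * (P * (P ^ b) ^ r * M ^ a)
          ≈⟨ *-congˡ (*-congʳ (trans (*-congˡ (^-assocʳ P b r)) (trans (^-congʳ P 1+br≡as) (P^a*s a)))) ⟩
        (x ^ a) ^ r * ((P ^ s) ^ a * M ^ a)
          ≈⟨ raised a ⟩
        (y ^ a) ^ r * Q ^ a ∎)

-- Derivations and orders of vanishing.

module _ {c ℓ : Level} (R : CommutativeRing c ℓ) where
  open CommutativeRing R

  record IsDerivation (δ : Carrier → Carrier) : Set (c ⊔ ℓ) where
    field
      δ-cong : ∀ {f g} → f ≈ g → δ f ≈ δ g
      δ-+    : ∀ f g → δ (f + g) ≈ δ f + δ g
      δ-*    : ∀ f g → δ (f * g) ≈ δ f * g + f * δ g

module Derivation {c ℓ : Level} (R : CommutativeRing c ℓ)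
                  {δ : CommutativeRing.Carrier R → CommutativeRing.Carrier R} (isDerivation : IsDerivation R δ) where

  open CommutativeRing R
  open IsDerivation isDerivation
  open Comaximality R
  open import Algebra.Properties.Semiring.Mult semiring renaming (_×_ to _×ℕ_)
  open import Algebra.Properties.Ring ring using (x+x≈x⇒x≈0)
  open import Algebra.Properties.CommutativeSemiring.Exp commutativeSemiring
    using (_^_; ^-congˡ; ^-distrib-*)
  open import Algebra.Properties.Semiring.Divisibility semiring
    using (_∣_; _∥_; _,_; ∣-trans; ∣-respʳ; ∣-respˡ; x∣yx)
  open import Algebra.Properties.CommutativeSemigroup.Divisibility *-commutativeSemigroup
    using (∙-cong-∣)
  open import Algebra.Solver.Ring.NaturalCoefficients.Default commutativeSemiring
    using (solve; _:+_; _:*_; _:=_)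
  open import Relation.Binary.Reasoning.Setoid setoid

  δ-≈0 : ∀ {f} → f ≈ 0# → δ f ≈ 0#
  δ-≈0 f≈0 = trans (δ-cong f≈0) (x+x≈x⇒x≈0 (δ 0#) (trans (sym (δ-+ 0# 0#)) (δ-cong (+-identityˡ 0#))))

  δ-1 : δ 1# ≈ 0#
  δ-1 = x+x≈x⇒x≈0 (δ 1#) (sym (begin
    δ 1#                     ≈⟨ δ-cong (*-identityˡ 1#) ⟨
    δ (1# * 1#)              ≈⟨ δ-* 1# 1# ⟩
    δ 1# * 1# + 1# * δ 1#    ≈⟨ +-cong (*-identityʳ _) (*-identityˡ _) ⟩
    δ 1# + δ 1#              ∎))

  δ-^ : ∀ f n → δ (f ^ suc n) ≈ suc n ×ℕ (f ^ n * δ f)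
  δ-^ f zero = begin
    δ (f * 1#)            ≈⟨ δ-cong (*-identityʳ f) ⟩
    δ f                   ≈⟨ *-identityˡ (δ f) ⟨
    1# * δ f              ≈⟨ +-identityʳ _ ⟨
    1# * δ f + 0#         ∎
  δ-^ f (suc n) = begin
    δ (f * f ^ suc n)                             ≈⟨ δ-* f (f ^ suc n) ⟩
    δ f * f ^ suc n + f * δ (f ^ suc n)           ≈⟨ +-cong (*-comm _ _) (*-congˡ (δ-^ f n)) ⟩
    f ^ suc n * δ f + f * (suc n ×ℕ (f ^ n * δ f)) ≈⟨ +-congˡ (×-comm-* (suc n) f _) ⟩
    f ^ suc n * δ f + suc n ×ℕ (f * (f ^ n * δ f)) ≈⟨ +-congˡ (×-congʳ (suc n) (*-assoc f _ _)) ⟨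
    f ^ suc n * δ f + suc n ×ℕ (f ^ suc n * δ f)   ∎

  ^∣⇒^∣δ : ∀ n {β f} → β ^ suc n ∣ f → β ^ n ∣ δ f
  ^∣⇒^∣δ n {β} {f} (q , qβ≈f) = ∣-respʳ (begin
    (δ q * β) * β ^ n + q * (suc n ×ℕ 1# * δ β) * β ^ n
      ≈⟨ solve 6 (λ q′ q b bⁿ m b′ → q′ :* b :* bⁿ :+ q :* (m :* b′) :* bⁿ
           := q′ :* (b :* bⁿ) :+ q :* (m :* (bⁿ :* b′)))
         refl (δ q) q β (β ^ n) (suc n ×ℕ 1#) (δ β) ⟩
    δ q * β ^ suc n + q * (suc n ×ℕ 1# * (β ^ n * δ β))
      ≈⟨ +-congˡ (*-congˡ (trans (×-assoc-* (suc n) 1# _) (×-congʳ (suc n) (*-identityˡ _)))) ⟩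
    δ q * β ^ suc n + q * (suc n ×ℕ (β ^ n * δ β))
      ≈⟨ +-congˡ (*-congˡ (δ-^ β n)) ⟨
    δ q * β ^ suc n + q * δ (β ^ suc n)
      ≈⟨ δ-* q (β ^ suc n) ⟨
    δ (q * β ^ suc n)
      ≈⟨ δ-cong qβ≈f ⟩
    δ f ∎)
    (∣-+ (x∣yx (β ^ n) _) (x∣yx (β ^ n) _))

  -- The logarithmic derivative of a product is a sum, and `E` clears the denominator of each term.
  -- The divisor `g` may be smaller than `f₁`: for `f₁` equal to `β ^ suc n` up to a unit, it is
  -- `β ^ n` that is known to divide the derivative.
  ∣-δ-* : ∀ {E f₀ f₁ g} → f₀ ∣ E * δ f₀ → g ∣ f₁ → g ∣ E * δ f₁ → f₀ * g ∣ E * δ (f₀ * f₁)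
  ∣-δ-* {E} {f₀} {f₁} {g} f₀∣ g∣f₁ g∣ = ∣-respʳ (begin
    (E * δ f₀) * f₁ + f₀ * (E * δ f₁)
      ≈⟨ solve 5 (λ E f₀ f₁ f₀′ f₁′ → E :* f₀′ :* f₁ :+ f₀ :* (E :* f₁′)
           := E :* (f₀′ :* f₁ :+ f₀ :* f₁′)) refl E f₀ f₁ (δ f₀) (δ f₁) ⟩
    E * (δ f₀ * f₁ + f₀ * δ f₁)
      ≈⟨ *-congˡ (δ-* f₀ f₁) ⟨
    E * δ (f₀ * f₁) ∎)
    (∣-+ (∙-cong-∣ f₀∣ g∣f₁) (∙-cong-∣ (1# , *-identityˡ f₀) g∣))

  -- The order of vanishing of W is bounded below by that of f minus one at
  -- every zero of f; at the zeros of E this loss is absorbed by E, elsewhere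
  -- f vanishes to an order divisible by n + 1.
  ramification : ∀ n {E f f₀ f₁ β k l m W} → f₀ * f₁ ≈ f → f₀ ∣ E * δ f₀ →
                 f₁ ∥ β ^ suc n → f ⊥ m → k * f + m * W ≈ l * δ f →
                 f ^ n ∣ W ^ suc n * E ^ n
  ramification n {E} {f} {f₀} {f₁} {β} {k} {l} {m} {W} f₀f₁≈f f₀∣Eδf₀ (f₁∣β , β∣f₁) f⊥m rel =
    -- `W ^ suc n * E ^ n` is `W * (E * W) ^ n`: the single `W` absorbs `β ^ n`, and each of the `n`
    -- copies of `E * W` absorbs `f₀ * β ^ n`.
    ∣-trans (∣-^ n f∣) (∣-respˡ (sym (begin
      (f₀ * β ^ suc n) ^ n
        ≈⟨ ^-congˡ n (solve 3 (λ a b c → a :* (b :* c) := b :* (a :* c)) refl f₀ β (β ^ n)) ⟩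
      (β * (f₀ * β ^ n)) ^ n      ≈⟨ ^-distrib-* β (f₀ * β ^ n) n ⟩
      β ^ n * (f₀ * β ^ n) ^ n    ∎)) (∣-respʳ (begin
      W * (E * W) ^ n             ≈⟨ *-congˡ (^-distrib-* E W n) ⟩
      W * (E ^ n * W ^ n)         ≈⟨ solve 3 (λ w e z → w :* (e :* z) := w :* z :* e) refl W (E ^ n) (W ^ n) ⟩
      W ^ suc n * E ^ n           ∎) (∙-cong-∣ βⁿ∣W (∣-^ n g∣EW))))
    where
    f∣ : f ∣ f₀ * β ^ suc n
    f∣ = ∣-respˡ f₀f₁≈f (∙-cong-∣ (1# , *-identityˡ f₀) f₁∣β)
    βⁿ∣f₁ : β ^ n ∣ f₁
    βⁿ∣f₁ = ∣-trans (x∣yx (β ^ n) β) β∣f₁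
    g∣f : f₀ * β ^ n ∣ f
    g∣f = ∣-respʳ f₀f₁≈f (∙-cong-∣ (1# , *-identityˡ f₀) βⁿ∣f₁)
    βⁿ∣f : β ^ n ∣ f
    βⁿ∣f = ∣-trans (x∣yx (β ^ n) f₀) g∣f
    βⁿ∣δf : β ^ n ∣ δ f
    βⁿ∣δf = ^∣⇒^∣δ n (∣-trans β∣f₁ (f₀ , f₀f₁≈f))
    βⁿ∣W : β ^ n ∣ W
    βⁿ∣W = ⊥-gauss (⊥-∣ˡ βⁿ∣f f⊥m) (∣-cancel-+ˡ (∣-trans βⁿ∣f (x∣yx f k))
      (∣-respʳ (sym rel) (∣-trans βⁿ∣δf (x∣yx (δ f) l))))
    g∣Eδf : f₀ * β ^ n ∣ E * δ f
    g∣Eδf = ∣-respʳ (*-congˡ (δ-cong f₀f₁≈f))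
      (∣-δ-* f₀∣Eδf₀ βⁿ∣f₁ (∣-trans (^∣⇒^∣δ n β∣f₁) (x∣yx (δ f₁) E)))
    g∣EW : f₀ * β ^ n ∣ E * W
    g∣EW = ⊥-gauss (⊥-∣ˡ g∣f f⊥m) (∣-cancel-+ˡ (∣-trans g∣f (x∣yx f (E * k))) (∣-respʳ (begin
      l * (E * δ f)                ≈⟨ solve 3 (λ l e f → l :* (e :* f) := e :* (l :* f)) refl l E (δ f) ⟩
      E * (l * δ f)                ≈⟨ *-congˡ rel ⟨
      E * (k * f + m * W)
        ≈⟨ solve 5 (λ e k f m w → e :* (k :* f :+ m :* w)
             := e :* k :* f :+ m :* (e :* w)) refl E k f m W ⟩
      E * k * f + m * (E * W)      ∎) (∣-trans g∣Eδf (x∣yx (E * δ f) l))))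

-- The polynomial ring and the derivation d/dt.

module Polynomials {c ℓ : Level} (R : CommutativeRing c ℓ) where

  open CommutativeRing R
  open Poly R hiding (Carrier; _≈_; 0#; 1#; setoid)
  open import Algebra.Properties.Semiring.Mult semiring renaming (_×_ to _×ℕ_)
  open Multiples R using (×-zeroʳ)
  open import Algebra.Properties.CommutativeSemigroup +-commutativeSemigroup using (interchange)
  open import Algebra.Properties.Ring ring using (-0#≈0#)
  open import Relation.Binary.Reasoning.Setoid setoid

  Σ≤-cong : ∀ {f g} n → (∀ i → i ≤ n → f i ≈ g i) → Σ≤ f n ≈ Σ≤ g n
  Σ≤-cong zero    f≈g = f≈g 0 z≤n
  Σ≤-cong (suc n) f≈g = +-cong (Σ≤-cong n (λ i i≤n → f≈g i (ℕ.m≤n⇒m≤1+n i≤n))) (f≈g (suc n) ℕ.≤-refl)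

  Σ≤-zero : ∀ {f} n → (∀ i → i ≤ n → f i ≈ 0#) → Σ≤ f n ≈ 0#
  Σ≤-zero zero    f≈0 = f≈0 0 z≤n
  Σ≤-zero (suc n) f≈0 =
    trans (+-cong (Σ≤-zero n (λ i i≤n → f≈0 i (ℕ.m≤n⇒m≤1+n i≤n))) (f≈0 (suc n) ℕ.≤-refl)) (+-identityˡ 0#)

  Σ≤-only : ∀ {f} n k → k ≤ n → (∀ i → i ≤ n → ¬ (i ≡ k) → f i ≈ 0#) → Σ≤ f n ≈ f k
  Σ≤-only zero    zero z≤n f≈0 = refl
  Σ≤-only {f} (suc n) k k≤1+n f≈0 with ℕ.m≤n⇒m<n∨m≡n k≤1+n
  ... | inj₁ (s≤s k≤n) = trans
    (+-cong (Σ≤-only n k k≤n (λ i i≤n → f≈0 i (ℕ.m≤n⇒m≤1+n i≤n)))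
            (f≈0 (suc n) ℕ.≤-refl (λ eq → ℕ.<⇒≢ (s≤s k≤n) (≡.sym eq))))
    (+-identityʳ (f k))
  ... | inj₂ ≡.refl = trans
    (+-congʳ (Σ≤-zero n (λ i i≤n → f≈0 i (ℕ.m≤n⇒m≤1+n i≤n) (ℕ.<⇒≢ (s≤s i≤n)))))
    (+-identityˡ (f (suc n)))

  Σ≤-+ : ∀ f g n → Σ≤ (λ i → f i + g i) n ≈ Σ≤ f n + Σ≤ g n
  Σ≤-+ f g zero    = refl
  Σ≤-+ f g (suc n) = trans (+-congʳ (Σ≤-+ f g n)) (interchange _ _ _ _)

  Σ≤-*ˡ : ∀ a f n → Σ≤ (λ i → a * f i) n ≈ a * Σ≤ f n
  Σ≤-*ˡ a f zero    = refl
  Σ≤-*ˡ a f (suc n) = trans (+-congʳ (Σ≤-*ˡ a f n)) (sym (distribˡ a _ _))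

  Σ≤-head : ∀ f n → Σ≤ f (suc n) ≈ f 0 + Σ≤ (λ i → f (suc i)) n
  Σ≤-head f zero    = refl
  Σ≤-head f (suc n) = trans (+-congʳ (Σ≤-head f n)) (+-assoc _ _ _)

  tail : Seq → Seq
  tail f n = f (suc n)

  *ₚ-cong : ∀ {f f′ g g′} → f ≈ₚ f′ → g ≈ₚ g′ → f *ₚ g ≈ₚ f′ *ₚ g′
  *ₚ-cong f≈f′ g≈g′ n = Σ≤-cong n (λ i _ → *-cong (f≈f′ i) (g≈g′ (n ∸ i)))

  *ₚ-tail : ∀ f g n → (f *ₚ g) (suc n) ≈ f 0 * g (suc n) + (tail f *ₚ g) n
  *ₚ-tail f g n = Σ≤-head (λ i → f i * g (suc n ∸ i)) n

  -- Removing the constant terms of both factors leaves the product of the tails two indices lower;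
  -- hence the two base cases.
  *ₚ-comm : ∀ f g → f *ₚ g ≈ₚ g *ₚ f
  *ₚ-comm f g zero          = *-comm (f 0) (g 0)
  *ₚ-comm f g (suc zero)    = trans (+-comm _ _) (+-cong (*-comm _ _) (*-comm _ _))
  *ₚ-comm f g (suc (suc n)) = begin
    (f *ₚ g) (suc (suc n))
      ≈⟨ *ₚ-tail f g (suc n) ⟩
    f 0 * g (suc (suc n)) + (tail f *ₚ g) (suc n)
      ≈⟨ +-congˡ (trans (*ₚ-comm (tail f) g (suc n)) (*ₚ-tail g (tail f) n)) ⟩
    f 0 * g (suc (suc n)) + (g 0 * f (suc (suc n)) + (tail g *ₚ tail f) n)
      ≈⟨ +-assoc _ _ _ ⟨
    f 0 * g (suc (suc n)) + g 0 * f (suc (suc n)) + (tail g *ₚ tail f) n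
      ≈⟨ +-cong (+-comm _ _) (*ₚ-comm (tail g) (tail f) n) ⟩
    g 0 * f (suc (suc n)) + f 0 * g (suc (suc n)) + (tail f *ₚ tail g) n
      ≈⟨ +-assoc _ _ _ ⟩
    g 0 * f (suc (suc n)) + (f 0 * g (suc (suc n)) + (tail f *ₚ tail g) n)
      ≈⟨ +-congˡ (trans (*ₚ-comm (tail g) f (suc n)) (*ₚ-tail f (tail g) n)) ⟨
    g 0 * f (suc (suc n)) + (tail g *ₚ f) (suc n)
      ≈⟨ *ₚ-tail g f (suc n) ⟨
    (g *ₚ f) (suc (suc n)) ∎

  *ₚ-distribʳ : ∀ h f g → (f +ₚ g) *ₚ h ≈ₚ (f *ₚ h) +ₚ (g *ₚ h)
  *ₚ-distribʳ h f g n = trans (Σ≤-cong n (λ i _ → distribʳ _ (f i) (g i))) (Σ≤-+ _ _ n)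

  *ₚ-assoc : ∀ f g h → (f *ₚ g) *ₚ h ≈ₚ f *ₚ (g *ₚ h)
  *ₚ-assoc f g h zero    = *-assoc _ _ _
  *ₚ-assoc f g h (suc n) = begin
    ((f *ₚ g) *ₚ h) (suc n)
      ≈⟨ *ₚ-tail (f *ₚ g) h n ⟩
    f 0 * g 0 * h (suc n) + (tail (f *ₚ g) *ₚ h) n
      ≈⟨ +-congˡ (*ₚ-cong {g = h} (*ₚ-tail f g) (λ _ → refl) n) ⟩
    f 0 * g 0 * h (suc n) + (((λ i → f 0 * tail g i) +ₚ (tail f *ₚ g)) *ₚ h) n
      ≈⟨ +-congˡ (*ₚ-distribʳ h _ (tail f *ₚ g) n) ⟩
    f 0 * g 0 * h (suc n) + (((λ i → f 0 * tail g i) *ₚ h) n + ((tail f *ₚ g) *ₚ h) n)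
      ≈⟨ +-congˡ (+-cong (trans (Σ≤-cong n (λ i _ → *-assoc _ _ _)) (Σ≤-*ˡ (f 0) _ n)) (*ₚ-assoc (tail f) g h n)) ⟩
    f 0 * g 0 * h (suc n) + (f 0 * (tail g *ₚ h) n + (tail f *ₚ (g *ₚ h)) n)
      ≈⟨ +-assoc _ _ _ ⟨
    f 0 * g 0 * h (suc n) + f 0 * (tail g *ₚ h) n + (tail f *ₚ (g *ₚ h)) n
      ≈⟨ +-congʳ (trans (+-congʳ (*-assoc _ _ _)) (sym (distribˡ _ _ _))) ⟩
    f 0 * (g 0 * h (suc n) + (tail g *ₚ h) n) + (tail f *ₚ (g *ₚ h)) n
      ≈⟨ +-congʳ (*-congˡ (*ₚ-tail g h n)) ⟨
    f 0 * (g *ₚ h) (suc n) + (tail f *ₚ (g *ₚ h)) n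
      ≈⟨ *ₚ-tail f (g *ₚ h) n ⟨
    (f *ₚ (g *ₚ h)) (suc n) ∎

  *ₚ-zeroˡ : ∀ f → 0ₚ *ₚ f ≈ₚ 0ₚ
  *ₚ-zeroˡ f n = Σ≤-zero n (λ i _ → zeroˡ _)

  *ₚ-identityˡ : ∀ f → 1ₚ *ₚ f ≈ₚ f
  *ₚ-identityˡ f zero    = *-identityˡ (f 0)
  *ₚ-identityˡ f (suc n) = trans (*ₚ-tail 1ₚ f n)
    (trans (+-cong (*-identityˡ _) (*ₚ-zeroˡ f n)) (+-identityʳ _))

  -- `N` and `M` are strict degree bounds, so the product vanishes already from index `N + M - 1`.
  -- This sharp form makes ordinary degree bounds additive.
  *ₚ-vanish : ∀ {f g N M n} → (∀ i → N ≤ i → f i ≈ 0#) → (∀ i → M ≤ i → g i ≈ 0#) →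
              N ℕ.+ M ≤ suc n → (f *ₚ g) n ≈ 0#
  *ₚ-vanish {f} {g} {N} {M} {n} f≈0 g≈0 N+M≤1+n = Σ≤-zero n vanish
    where
    vanish : ∀ i → i ≤ n → f i * g (n ∸ i) ≈ 0#
    vanish i i≤n with N ≤? i
    ... | yes N≤i = trans (*-congʳ (f≈0 i N≤i)) (zeroˡ _)
    ... | no  N≰i = trans (*-congˡ (g≈0 (n ∸ i) (ℕ.+-cancelˡ-≤ (suc i) M (n ∸ i)
      (ℕ.≤-trans (ℕ.+-monoˡ-≤ M (ℕ.≰⇒> N≰i)) (ℕ.≤-trans N+M≤1+n
        (s≤s (ℕ.≤-reflexive (≡.sym (ℕ.m+[n∸m]≡n i≤n))))))))) (zeroʳ _)

  record Polynomial : Set (c ⊔ ℓ) where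
    no-eta-equality
    constructor mkPolynomial
    field
      coeff  : Seq
      isPoly : IsPoly coeff

  open Polynomial public

  infix 4 _≈ᴾ_

  -- As a record, an equality determines the two polynomials it relates, which a bare pointwise
  -- equality of coefficients does not.
  record _≈ᴾ_ (f g : Polynomial) : Set ℓ where
    constructor coeffwise
    field
      coeff≈ : coeff f ≈ₚ coeff g

  open _≈ᴾ_ public

  infixl 6 _+ᴾ_
  infixl 7 _*ᴾ_

  _+ᴾ_ : Polynomial → Polynomial → Polynomial
  coeff  (f +ᴾ g) = coeff f +ₚ coeff g
  isPoly (f +ᴾ g) with isPoly f | isPoly g
  ... | N , f≈0 | M , g≈0 = N ℕ.+ M , λ n N+M≤n → trans
    (+-cong (f≈0 n (ℕ.≤-trans (ℕ.m≤m+n N M) N+M≤n)) (g≈0 n (ℕ.≤-trans (ℕ.m≤n+m M N) N+M≤n)))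
    (+-identityˡ 0#)

  _*ᴾ_ : Polynomial → Polynomial → Polynomial
  coeff  (f *ᴾ g) = coeff f *ₚ coeff g
  isPoly (f *ᴾ g) with isPoly f | isPoly g
  ... | N , f≈0 | M , g≈0 = N ℕ.+ M , λ n N+M≤n → *ₚ-vanish f≈0 g≈0 (ℕ.m≤n⇒m≤1+n N+M≤n)

  -ᴾ_ : Polynomial → Polynomial
  coeff  (-ᴾ f) n = - coeff f n
  isPoly (-ᴾ f) with isPoly f
  ... | N , f≈0 = N , λ n N≤n → trans (-‿cong (f≈0 n N≤n)) -0#≈0#

  0ᴾ : Polynomial
  coeff  0ᴾ = 0ₚ
  isPoly 0ᴾ = 0 , λ _ _ → refl

  1ᴾ : Polynomial
  coeff  1ᴾ = 1ₚ
  isPoly 1ᴾ = 1 , λ { (suc n) _ → refl }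

  polynomialRing : CommutativeRing (c ⊔ ℓ) ℓ
  polynomialRing = record
    { Carrier = Polynomial
    ; _≈_ = _≈ᴾ_
    ; _+_ = _+ᴾ_
    ; _*_ = _*ᴾ_
    ; -_  = -ᴾ_
    ; 0#  = 0ᴾ
    ; 1#  = 1ᴾ
    ; isCommutativeRing = record
      { isRing = record
        { +-isAbelianGroup = record
          { isGroup = record
            { isMonoid = record
              { isSemigroup = record
                { isMagma = record
                  { isEquivalence = record
                    { refl  = coeffwise λ _ → refl
                    ; sym   = λ p → coeffwise λ n → sym (coeff≈ p n)
                    ; trans = λ p q → coeffwise λ n → trans (coeff≈ p n) (coeff≈ q n)
                    }
                  ; ∙-cong = λ p q → coeffwise λ n → +-cong (coeff≈ p n) (coeff≈ q n)
                  }
                ; assoc = λ f g h → coeffwise λ n → +-assoc _ _ _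
                }
              ; identity = (λ f → coeffwise λ n → +-identityˡ _) , (λ f → coeffwise λ n → +-identityʳ _)
              }
            ; inverse = (λ f → coeffwise λ n → -‿inverseˡ _) , (λ f → coeffwise λ n → -‿inverseʳ _)
            ; ⁻¹-cong = λ p → coeffwise λ n → -‿cong (coeff≈ p n)
            }
          ; comm = λ f g → coeffwise λ n → +-comm _ _
          }
        ; *-cong = λ p q → coeffwise (*ₚ-cong (coeff≈ p) (coeff≈ q))
        ; *-assoc = λ f g h → coeffwise (*ₚ-assoc (coeff f) (coeff g) (coeff h))
        ; *-identity = (λ f → coeffwise (*ₚ-identityˡ (coeff f))) ,
                       (λ f → coeffwise λ n → trans (*ₚ-comm (coeff f) 1ₚ n) (*ₚ-identityˡ (coeff f) n))
        ; distrib = (λ f g h → coeffwise λ n → trans (*ₚ-comm (coeff f) (coeff g +ₚ coeff h) n)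
                      (trans (*ₚ-distribʳ (coeff f) (coeff g) (coeff h) n)
                        (+-cong (*ₚ-comm (coeff g) (coeff f) n) (*ₚ-comm (coeff h) (coeff f) n)))) ,
                    (λ f g h → coeffwise (*ₚ-distribʳ (coeff f) (coeff g) (coeff h)))
        }
      ; *-comm = λ f g → coeffwise (*ₚ-comm (coeff f) (coeff g))
      }
    }

  -- t d/dt is visibly a derivation of the Cauchy product, and its shift is d/dt.
  euler : Seq → Seq
  euler f n = n ×ℕ f n

  euler-* : ∀ f g → euler (f *ₚ g) ≈ₚ (euler f *ₚ g) +ₚ (f *ₚ euler g)
  euler-* f g n = begin
    n ×ℕ Σ≤ (λ i → f i * g (n ∸ i)) n
      ≈⟨ trans (×-congʳ n (sym (*-identityˡ _))) (sym (×-assoc-* n 1# _)) ⟩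
    (n ×ℕ 1#) * Σ≤ (λ i → f i * g (n ∸ i)) n
      ≈⟨ Σ≤-*ˡ (n ×ℕ 1#) _ n ⟨
    Σ≤ (λ i → (n ×ℕ 1#) * (f i * g (n ∸ i))) n
      ≈⟨ Σ≤-cong n term ⟩
    Σ≤ (λ i → euler f i * g (n ∸ i) + f i * euler g (n ∸ i)) n
      ≈⟨ Σ≤-+ _ _ n ⟩
    (euler f *ₚ g) n + (f *ₚ euler g) n ∎
    where
    term : ∀ i → i ≤ n → (n ×ℕ 1#) * (f i * g (n ∸ i)) ≈ euler f i * g (n ∸ i) + f i * euler g (n ∸ i)
    term i i≤n = begin
      (n ×ℕ 1#) * (f i * g (n ∸ i))   ≈⟨ trans (×-assoc-* n 1# _) (×-congʳ n (*-identityˡ _)) ⟩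
      n ×ℕ (f i * g (n ∸ i))          ≈⟨ ×-congˡ (≡.sym (ℕ.m+[n∸m]≡n i≤n)) ⟩
      (i ℕ.+ (n ∸ i)) ×ℕ (f i * g (n ∸ i)) ≈⟨ ×-homo-+ _ i (n ∸ i) ⟩
      i ×ℕ (f i * g (n ∸ i)) + (n ∸ i) ×ℕ (f i * g (n ∸ i))
        ≈⟨ +-cong (×-assoc-* i _ _) (×-comm-* (n ∸ i) _ _) ⟨
      euler f i * g (n ∸ i) + f i * euler g (n ∸ i) ∎

  euler-tail-* : ∀ f g n → (euler f *ₚ g) (suc n) ≈ (tail (euler f) *ₚ g) n
  euler-tail-* f g n = trans (*ₚ-tail (euler f) g n) (trans (+-congʳ (zeroˡ _)) (+-identityˡ _))

  ∂ : Polynomial → Polynomial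
  coeff  (∂ f) = tail (euler (coeff f))
  isPoly (∂ f) with isPoly f
  ... | N , f≈0 = N , λ n N≤n → trans (×-congʳ (suc n) (f≈0 (suc n) (ℕ.m≤n⇒m≤1+n N≤n))) (×-zeroʳ (suc n))

  ∂-isDerivation : IsDerivation polynomialRing ∂
  ∂-isDerivation = record
    { δ-cong = λ p → coeffwise λ n → ×-congʳ (suc n) (coeff≈ p (suc n))
    ; δ-+ = λ f g → coeffwise λ n → ×-distrib-+ _ _ (suc n)
    ; δ-* = λ f g → coeffwise λ n → trans (euler-* (coeff f) (coeff g) (suc n))
        (+-cong (euler-tail-* (coeff f) (coeff g) n)
          (trans (*ₚ-comm (coeff f) _ (suc n)) (trans (euler-tail-* (coeff g) (coeff f) n) (*ₚ-comm _ (coeff f) n))))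
    }
    where open import Algebra.Properties.CommutativeMonoid.Mult +-commutativeMonoid using (×-distrib-+)

-- Degrees, Euclid's algorithm, and splitting a polynomial along another.

module Degrees {c ℓ : Level} (F : CommutativeRing c ℓ)
               (isField : Poly.IsField F) (≈0? : ∀ x → Dec (CommutativeRing._≈_ F x (CommutativeRing.0# F)))
               where

  open Poly F using (DegLe; tpow; 1ₚ; _≈ₚ_)
  open Polynomials F
  private module K = CommutativeRing F
  open Multiples F using (×-zeroʳ)
  open CommutativeRing polynomialRing
  open Comaximality polynomialRing
  open import Algebra.Properties.CommutativeSemiring.Exp commutativeSemiring
    using (_^_)
  open import Algebra.Properties.Semiring.Divisibility semiring
    using (_∣_; _,_; ∣-trans; ∣-respʳ; ∣-respˡ; ∣-refl; x∣yx; _∣0; 0∣x⇒x≈0)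
  open import Algebra.Properties.CommutativeSemigroup.Divisibility *-commutativeSemigroup
    using (∙-cong-∣)
  open import Algebra.Properties.Ring ring using (-‿distribʳ-*)
  open import Algebra.Properties.Group +-group using () renaming (x∙y⁻¹≈ε⇒x≈y to x-y≈0⇒x≈y)
  open import Algebra.Properties.Ring K.ring using (-‿involutive) renaming (-0#≈0# to K-0≈0)
  open Derivation polynomialRing ∂-isDerivation using (∣-δ-*)
  open import Algebra.Solver.Ring.NaturalCoefficients.Default commutativeSemiring
    using (solve; _:+_; _:*_; _:=_)

  record Deg (f : Polynomial) (n : ℕ) : Set ℓ where
    constructor _,_
    field
      leading≉0 : ¬ (coeff f n K.≈ K.0#)
      degLe     : DegLe (coeff f) n

  open Deg public

  K-*-≉0 : ∀ {x y} → ¬ (x K.≈ K.0#) → ¬ (y K.≈ K.0#) → ¬ (x K.* y K.≈ K.0#)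
  K-*-≉0 {x} {y} x≉0 y≉0 xy≈0 = y≉0 (begin
    y                ≈⟨ K.*-identityˡ y ⟨
    K.1# K.* y       ≈⟨ K.*-congʳ xx⁻¹≈1 ⟨
    x K.* x⁻¹ K.* y  ≈⟨ K.trans (K.*-congʳ (K.*-comm x x⁻¹)) (K.*-assoc x⁻¹ x y) ⟩
    x⁻¹ K.* (x K.* y) ≈⟨ K.*-congˡ xy≈0 ⟩
    x⁻¹ K.* K.0#     ≈⟨ K.zeroʳ x⁻¹ ⟩
    K.0#             ∎)
    where
    open import Relation.Binary.Reasoning.Setoid K.setoid
    x⁻¹ : K.Carrier
    x⁻¹ = proj₁ (proj₂ isField x x≉0)
    xx⁻¹≈1 : x K.* x⁻¹ K.≈ K.1#
    xx⁻¹≈1 = proj₂ (proj₂ isField x x≉0)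

  degLe-weaken : ∀ {f m n} → m ≤ n → DegLe (coeff f) m → DegLe (coeff f) n
  degLe-weaken m≤n f≤m i n<i = f≤m i (ℕ.≤-<-trans m≤n n<i)

  degLe-cong : ∀ {f g n} → f ≈ g → DegLe (coeff f) n → DegLe (coeff g) n
  degLe-cong f≈g f≤n i n<i = K.trans (K.sym (coeff≈ f≈g i)) (f≤n i n<i)

  degLe-+ : ∀ {f g n} → DegLe (coeff f) n → DegLe (coeff g) n → DegLe (coeff (f + g)) n
  degLe-+ f≤n g≤n i n<i = K.trans (K.+-cong (f≤n i n<i) (g≤n i n<i)) (K.+-identityˡ K.0#)

  degLe-* : ∀ f g {m n} → DegLe (coeff f) m → DegLe (coeff g) n → DegLe (coeff (f * g)) (m ℕ.+ n)
  degLe-* f g {m} {n} f≤m g≤n i m+n<i = *ₚ-vanish {coeff f} {coeff g} {suc m} {suc n} f≤m g≤n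
    (s≤s (ℕ.≤-trans (ℕ.≤-reflexive (ℕ.+-suc m n)) m+n<i))

  coeff-*-top : ∀ f g {m n} → DegLe (coeff f) m → DegLe (coeff g) n →
                coeff (f * g) (m ℕ.+ n) K.≈ coeff f m K.* coeff g n
  coeff-*-top f g {m} {n} f≤m g≤n = K.trans (Σ≤-only (m ℕ.+ n) m (ℕ.m≤m+n m n) other)
    (K.reflexive (≡.cong (λ k → coeff f m K.* coeff g k) (ℕ.m+n∸m≡n m n)))
    where
    other : ∀ i → i ≤ m ℕ.+ n → ¬ (i ≡ m) → coeff f i K.* coeff g (m ℕ.+ n ∸ i) K.≈ K.0#
    other i i≤m+n i≢m with i ≤? m
    ... | yes i≤m = K.trans (K.*-congˡ (g≤n _ (ℕ.≤-trans (s≤s (ℕ.≤-reflexive (≡.sym (ℕ.m+n∸m≡n m n))))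
            (ℕ.∸-monoʳ-< (ℕ.≤∧≢⇒< i≤m i≢m) (ℕ.m≤m+n m n))))) (K.zeroʳ _)
    ... | no  i≰m = K.trans (K.*-congʳ (f≤m i (ℕ.≰⇒> i≰m))) (K.zeroˡ _)

  deg-cong : ∀ {f g n} → f ≈ g → Deg f n → Deg g n
  deg-cong {f} {g} f≈g (fₙ≉0 , f≤n) =
    (λ gₙ≈0 → fₙ≉0 (K.trans (coeff≈ f≈g _) gₙ≈0)) , degLe-cong {f} {g} f≈g f≤n

  deg-* : ∀ {f g m n} → Deg f m → Deg g n → Deg (f * g) (m ℕ.+ n)
  deg-* {f} {g} (fₘ≉0 , f≤m) (gₙ≉0 , g≤n) =
    (λ eq → K-*-≉0 fₘ≉0 gₙ≉0 (K.trans (K.sym (coeff-*-top f g f≤m g≤n)) eq)) , degLe-* f g f≤m g≤n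

  deg-1 : Deg 1# 0
  deg-1 = proj₁ isField , λ { (suc i) _ → K.refl }

  deg-^ : ∀ {f m} n → Deg f m → Deg (f ^ n) (n ℕ.* m)
  deg-^ zero    f≐m = deg-1
  deg-^ (suc n) f≐m = deg-* f≐m (deg-^ n f≐m)

  degLe-^ : ∀ f {m} n → DegLe (coeff f) m → DegLe (coeff (f ^ n)) (n ℕ.* m)
  degLe-^ f zero    f≤m = degLe deg-1
  degLe-^ f (suc n) f≤m = degLe-* f (f ^ n) f≤m (degLe-^ f n f≤m)

  deg-+ : ∀ {f g m n} → Deg f m → DegLe (coeff g) n → n < m → Deg (f + g) m
  deg-+ {f} {g} {m} (fₘ≉0 , f≤m) g≤n n<m =
    (λ eq → fₘ≉0 (K.trans (K.sym (K.trans (K.+-congˡ (g≤n m n<m)) (K.+-identityʳ _))) eq)) ,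
    degLe-+ {f} {g} f≤m (degLe-weaken {g} (ℕ.<⇒≤ n<m) g≤n)

  degLe-neg : ∀ f {n} → DegLe (coeff f) n → DegLe (coeff (- f)) n
  degLe-neg f f≤n i n<i = K.trans (K.-‿cong (f≤n i n<i)) K-0≈0

  deg-neg : ∀ {f n} → Deg f n → Deg (- f) n
  deg-neg {f} (fₙ≉0 , f≤n) =
    (λ -fₙ≈0 → fₙ≉0 (K.trans (K.sym (-‿involutive _)) (K.trans (K.-‿cong -fₙ≈0) K-0≈0))) , degLe-neg f f≤n

  deg-minimal : ∀ {f m n} → Deg f m → DegLe (coeff f) n → m ≤ n
  deg-minimal (fₘ≉0 , _) f≤n = ℕ.≮⇒≥ (λ n<m → fₘ≉0 (f≤n _ n<m))

  deg-unique : ∀ {f m n} → Deg f m → Deg f n → m ≡ n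
  deg-unique f≐m f≐n = ℕ.≤-antisym (deg-minimal f≐m (degLe f≐n)) (deg-minimal f≐n (degLe f≐m))

  deg⇒≉0 : ∀ {f n} → Deg f n → ¬ (f ≈ 0#)
  deg⇒≉0 (fₙ≉0 , _) f≈0 = fₙ≉0 (coeff≈ f≈0 _)

  degree : ∀ f → f ≈ 0# ⊎ ∃ (Deg f)
  degree f = bounded (proj₁ (isPoly f)) (proj₂ (isPoly f))
    where
    bounded : ∀ N → (∀ n → N ≤ n → coeff f n K.≈ K.0#) → f ≈ 0# ⊎ ∃ (Deg f)
    bounded zero    f≈0 = inj₁ (coeffwise λ n → f≈0 n z≤n)
    bounded (suc N) f≈0 with ≈0? (coeff f N)
    ... | no  fₙ≉0 = inj₂ (N , fₙ≉0 , f≈0)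
    ... | yes fₙ≈0 = bounded N λ n N≤n → Sum.[ f≈0 n , (λ { ≡.refl → fₙ≈0 }) ]′ (ℕ.m≤n⇒m<n∨m≡n N≤n)

  ≉0⇒degree : ∀ f → ¬ (f ≈ 0#) → ∃ (Deg f)
  ≉0⇒degree f f≉0 = Sum.[ (λ f≈0 → ⊥-elim (f≉0 f≈0)) , (λ d → d) ]′ (degree f)

  *-cancelˡ : ∀ {a b c} → ¬ (a ≈ 0#) → a * b ≈ a * c → b ≈ c
  *-cancelˡ {a} {b} {c} a≉0 ab≈ac = Sum.[ x-y≈0⇒x≈y b c , nonzero ]′ (degree (b + - c))
    where
    nonzero : ∃ (Deg (b + - c)) → b ≈ c
    nonzero (_ , b-c≐n) = ⊥-elim (deg⇒≉0 (deg-* (proj₂ (≉0⇒degree a a≉0)) b-c≐n) (begin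
      a * (b + - c)     ≈⟨ distribˡ a b (- c) ⟩
      a * b + a * (- c) ≈⟨ +-cong ab≈ac (sym (-‿distribʳ-* a c)) ⟩
      a * c + - (a * c) ≈⟨ -‿inverseʳ (a * c) ⟩
      0#                ∎))
      where open import Relation.Binary.Reasoning.Setoid setoid

  ∣⇒deg≤ : ∀ {f g m n} → f ∣ g → Deg f m → Deg g n → m ≤ n
  ∣⇒deg≤ {f} {g} {m} {n} (q , qf≈g) f≐m g≐n = by-degree (degree q)
    where
    by-degree : q ≈ 0# ⊎ ∃ (Deg q) → m ≤ n
    by-degree (inj₁ q≈0) = ⊥-elim (deg⇒≉0 g≐n (trans (sym qf≈g) (trans (*-congʳ q≈0) (zeroˡ f))))
    by-degree (inj₂ (k , q≐k)) = ℕ.≤-trans (ℕ.m≤n+m m k)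
      (ℕ.≤-reflexive (deg-unique (deg-cong qf≈g (deg-* q≐k f≐m)) g≐n))

  const : K.Carrier → Polynomial
  coeff  (const x) zero    = x
  coeff  (const x) (suc _) = K.0#
  isPoly (const x) = 1 , λ { (suc _) _ → K.refl }

  degLe-const : ∀ x → DegLe (coeff (const x)) 0
  degLe-const x (suc _) _ = K.refl

  X : Polynomial
  coeff  X = tpow 1
  isPoly X = 2 , λ { (suc zero) (s≤s ()) ; (suc (suc _)) _ → K.refl }

  tpow-0 : tpow 0 ≈ₚ 1ₚ
  tpow-0 zero    = K.refl
  tpow-0 (suc n) = K.refl

  X*-tail : ∀ f n → coeff (X * f) (suc n) K.≈ coeff f n
  X*-tail f n = K.trans (*ₚ-tail (tpow 1) (coeff f) n) (K.trans
    (K.+-cong (K.zeroˡ _) (K.trans (*ₚ-cong {g = coeff f} tpow-0 (λ _ → K.refl) n) (*ₚ-identityˡ (coeff f) n)))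
    (K.+-identityˡ _))

  X^≈tpow : ∀ k → coeff (X ^ k) ≈ₚ tpow k
  X^≈tpow zero    n       = K.sym (tpow-0 n)
  X^≈tpow (suc k) zero    = K.zeroˡ _
  X^≈tpow (suc k) (suc n) = K.trans (X*-tail (X ^ k) n) (X^≈tpow k n)

  coeff-X^*-low : ∀ k f {n} → n < k → coeff (X ^ k * f) n K.≈ K.0#
  coeff-X^*-low (suc k) f {zero}  _ = K.trans (coeff≈ (*-assoc X (X ^ k) f) 0) (K.zeroˡ _)
  coeff-X^*-low (suc k) f {suc n} (s≤s n<k) = K.trans (coeff≈ (*-assoc X (X ^ k) f) (suc n))
    (K.trans (X*-tail (X ^ k * f) n) (coeff-X^*-low k f n<k))

  coeff-X^*-high : ∀ k f n → coeff (X ^ k * f) (k ℕ.+ n) K.≈ coeff f n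
  coeff-X^*-high zero    f n = *ₚ-identityˡ (coeff f) n
  coeff-X^*-high (suc k) f n = K.trans (coeff≈ (*-assoc X (X ^ k) f) (suc (k ℕ.+ n)))
    (K.trans (X*-tail (X ^ k * f) (k ℕ.+ n)) (coeff-X^*-high k f n))

  deg-X : Deg X 1
  deg-X = proj₁ isField , λ { (suc zero) (s≤s ()) ; (suc (suc _)) _ → K.refl }

  deg-X^ : ∀ k → Deg (X ^ k) k
  deg-X^ k = ≡.subst (Deg (X ^ k)) (ℕ.*-identityʳ k) (deg-^ k deg-X)

  ∂-X : ∂ X ≈ 1#
  ∂-X = coeffwise λ { zero → K.+-identityʳ K.1# ; (suc n) → ×-zeroʳ (suc (suc n)) }

  -- With the factor `X` the drop of degree under `∂` is expressed without subtracting from `n`.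
  -- This drop is the source of the strict inequality in the height bound.
  ∂-degLe : ∀ f {n} → DegLe (coeff f) n → DegLe (coeff (X * ∂ f)) n
  ∂-degLe f f≤n (suc i) n<1+i = K.trans (X*-tail (∂ f) i)
    (K.trans (×-congʳ (suc i) (f≤n (suc i) n<1+i)) (×-zeroʳ (suc i)))
    where open import Algebra.Properties.Semiring.Mult K.semiring using (×-congʳ)

  deg0⇒∣1 : ∀ {f} → Deg f 0 → f ∣ 1#
  deg0⇒∣1 {f} (f₀≉0 , f≤0) = const f₀⁻¹ , coeffwise λ
    { zero    → K.trans (K.*-comm _ _) (proj₂ (proj₂ isField (coeff f 0) f₀≉0))
    ; (suc n) → degLe-* (const f₀⁻¹) f {0} {0} (degLe-const f₀⁻¹) f≤0 (suc n) (s≤s z≤n) }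
    where
    f₀⁻¹ : K.Carrier
    f₀⁻¹ = proj₁ (proj₂ isField (coeff f 0) f₀≉0)

  ∣1⇒deg0 : ∀ {f} → f ∣ 1# → Deg f 0
  ∣1⇒deg0 {f} f∣1 = Sum.[ zero-case , (λ (n , f≐n) → ≡.subst (Deg f) (ℕ.n≤0⇒n≡0 (∣⇒deg≤ f∣1 f≐n deg-1)) f≐n) ]′ (degree f)
    where
    zero-case : f ≈ 0# → Deg f 0
    zero-case f≈0 = ⊥-elim (deg⇒≉0 deg-1 (0∣x⇒x≈0 (∣-respˡ f≈0 f∣1)))

  private
    Vanishes : Polynomial → ℕ → Set ℓ
    Vanishes f N = ∀ n → N ≤ n → coeff f n K.≈ K.0#

    GcdIdentity : Polynomial → Polynomial → Set (c ⊔ ℓ)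
    GcdIdentity a b = ∃ λ g → g ∣ a × g ∣ b × ∃₂ λ x y → x * a + y * b ≈ g

    gcd-sym : ∀ {a b} → GcdIdentity a b → GcdIdentity b a
    gcd-sym (g , g∣a , g∣b , x , y , eq) = g , g∣b , g∣a , y , x , trans (+-comm _ _) eq

    gcd-0ʳ : ∀ {a b} → b ≈ 0# → GcdIdentity a b
    gcd-0ʳ {a} b≈0 = a , ∣-refl , ∣-respʳ (sym b≈0) (a ∣0) , 1# , 0# ,
      trans (+-cong (*-identityˡ a) (zeroˡ _)) (+-identityʳ a)

    gcd-step : ∀ {a a′ b} q → a′ ≈ a + q * b → GcdIdentity a′ b → GcdIdentity a b
    gcd-step {a} {a′} {b} q a′≈ (g , g∣a′ , g∣b , x , y , eq) =
      g , ∣-cancel-+ˡ (∣-trans g∣b (x∣yx b q)) (∣-respʳ (trans a′≈ (+-comm _ _)) g∣a′) , g∣b ,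
      x , x * q + y ,
      trans (solve 5 (λ a b q x y → x :* a :+ (x :* q :+ y) :* b := x :* (a :+ q :* b) :+ y :* b) refl a b q x y)
        (trans (+-congʳ (*-congˡ (sym a′≈))) eq)

    vanishes-pred : ∀ {f N} → coeff f N K.≈ K.0# → Vanishes f (suc N) → Vanishes f N
    vanishes-pred {f} {N} f_N≈0 f≈0 n N≤n =
      Sum.[ f≈0 n , (λ { ≡.refl → f_N≈0 }) ]′ (ℕ.m≤n⇒m<n∨m≡n N≤n)

    cancel-leading : ∀ {a b N M} → Vanishes a (suc N) → Vanishes b (suc M) →
                     ¬ (coeff b M K.≈ K.0#) → M ≤ N → ∃ λ q → Vanishes (a + q * b) N
    cancel-leading {a} {b} {N} {M} a≈0 b≈0 b_M≉0 M≤N = q , vanishes-pred {a + q * b} top above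
      where
      open import Relation.Binary.Reasoning.Setoid K.setoid
      b⁻¹ : K.Carrier
      b⁻¹ = proj₁ (proj₂ isField (coeff b M) b_M≉0)
      k : ℕ
      k = N ∸ M
      lead : K.Carrier
      lead = K.- coeff a N K.* b⁻¹
      q : Polynomial
      q = const lead * X ^ k
      q≤k : DegLe (coeff q) k
      q≤k = degLe-* (const lead) (X ^ k) (degLe-const lead) (degLe (deg-X^ k))
      tpow-k : ∀ k → tpow k k K.≈ K.1#
      tpow-k zero    = K.refl
      tpow-k (suc k) = tpow-k k
      k+M≡N : k ℕ.+ M ≡ N
      k+M≡N = ℕ.m∸n+n≡m M≤N
      top : coeff (a + q * b) N K.≈ K.0#
      top = begin
        coeff a N K.+ coeff (q * b) N
          ≡⟨ ≡.cong (λ i → coeff a N K.+ coeff (q * b) i) k+M≡N ⟨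
        coeff a N K.+ coeff (q * b) (k ℕ.+ M)
          ≈⟨ K.+-congˡ (coeff-*-top q b q≤k b≈0) ⟩
        coeff a N K.+ coeff q k K.* coeff b M
          ≈⟨ K.+-congˡ (K.*-congʳ (coeff-*-top (const lead) (X ^ k) (degLe-const lead) (degLe (deg-X^ k)))) ⟩
        coeff a N K.+ (lead K.* coeff (X ^ k) k) K.* coeff b M
          ≈⟨ K.+-congˡ (K.*-congʳ (K.trans (K.*-congˡ (K.trans (X^≈tpow k k) (tpow-k k))) (K.*-identityʳ lead))) ⟩
        coeff a N K.+ lead K.* coeff b M
          ≈⟨ K.+-congˡ (K.trans (K.*-assoc _ _ _) (K.*-congˡ (K.trans (K.*-comm _ _) (proj₂ (proj₂ isField (coeff b M) b_M≉0))))) ⟩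
        coeff a N K.+ (K.- coeff a N) K.* K.1#
          ≈⟨ K.+-congˡ (K.*-identityʳ _) ⟩
        coeff a N K.+ K.- coeff a N
          ≈⟨ K.-‿inverseʳ _ ⟩
        K.0# ∎
      above : Vanishes (a + q * b) (suc N)
      above = degLe-+ {a} {q * b} a≈0
        (≡.subst (DegLe (coeff (q * b))) k+M≡N (degLe-* q b q≤k b≈0))

    -- Euclid's algorithm, one coefficient at a time. `N` and `M` are strict degree bounds that need
    -- not be sharp; whether a top coefficient is already zero or gets cancelled, one of them drops
    -- by one, and `k` bounds their sum.
    gcd-bounded : ∀ k {a b} N M → N ℕ.+ M ≤ k → Vanishes a N → Vanishes b M → GcdIdentity a b
    gcd-bounded k zero M _ a≈0 b≈0 = gcd-sym (gcd-0ʳ (coeffwise λ n → a≈0 n z≤n))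
    gcd-bounded k (suc N) zero _ a≈0 b≈0 = gcd-0ʳ (coeffwise λ n → b≈0 n z≤n)
    gcd-bounded (suc k) {a} {b} (suc N) (suc M) (s≤s N+M≤k) a≈0 b≈0
      with ≈0? (coeff a N) | ≈0? (coeff b M)
    ... | yes a_N≈0 | _ = gcd-bounded k N (suc M) N+M≤k (vanishes-pred {a} a_N≈0 a≈0) b≈0
    ... | no _ | yes b_M≈0 = gcd-bounded k (suc N) M
      (ℕ.≤-trans (ℕ.≤-reflexive (≡.sym (ℕ.+-suc N M))) N+M≤k) a≈0 (vanishes-pred {b} b_M≈0 b≈0)
    ... | no a_N≉0 | no b_M≉0 = Sum.[ reduce-left , reduce-right ]′ (ℕ.≤-total M N)
      where
      reduce-left : M ≤ N → GcdIdentity a b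
      reduce-left M≤N =
        let (q , a+qb≈0) = cancel-leading {a} {b} a≈0 b≈0 b_M≉0 M≤N
        in gcd-step q refl (gcd-bounded k N (suc M) N+M≤k a+qb≈0 b≈0)
      reduce-right : N ≤ M → GcdIdentity a b
      reduce-right N≤M =
        let (q , b+qa≈0) = cancel-leading {b} {a} b≈0 a≈0 a_N≉0 N≤M
        in gcd-sym (gcd-step q refl (gcd-sym (gcd-bounded k (suc N) M
             (ℕ.≤-trans (ℕ.≤-reflexive (≡.sym (ℕ.+-suc N M))) N+M≤k) a≈0 b+qa≈0)))

  isBézoutDomain : IsBézoutDomain polynomialRing
  isBézoutDomain = record
    { *-cancelˡ = *-cancelˡ
    ; 1≉0       = deg⇒≉0 deg-1
    ; bézout    = λ a b → gcd-bounded _ (proj₁ (isPoly a)) (proj₁ (isPoly b)) ℕ.≤-refl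
                    (proj₂ (isPoly a)) (proj₂ (isPoly b))
    }

  open IsBézoutDomain isBézoutDomain using (bézout)
  open PowerPart polynomialRing isBézoutDomain using (∣-≉0)

  -- f₀ is a product of divisors of E, so that E f₀′ / f₀ is a polynomial, and f₁
  -- has no zero in common with E.
  record Strip (E f : Polynomial) : Set (c ⊔ ℓ) where
    field
      {f₀ f₁}  : Polynomial
      factors  : f₀ * f₁ ≈ f
      f₀∣E∂f₀  : f₀ ∣ E * ∂ f₀
      exponent : ℕ
      f₀∣Eᵏ    : f₀ ∣ E ^ exponent
      f₁⊥E     : f₁ ⊥ E

  -- The gcd with `E` is divided out until it is a unit. Each gcd `g` divides `E`, so `E * ∂ g` is a
  -- multiple of `g`, and the product rule extends this to the product `f₀` of all of them. The
  -- remaining factor is coprime to `E`, and hence also to `f₀`, which divides a power of `E`.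
  strip : ∀ E f → ¬ (f ≈ 0#) → Strip E f
  strip E f f≉0 = bounded _ f (proj₂ (≉0⇒degree f f≉0)) ℕ.≤-refl
    where
    bounded : ∀ k f {n} → Deg f n → n ≤ k → Strip E f
    by-gcd : ∀ k f {n m} → Deg f n → n ≤ k → ((g , _) : GcdIdentity f E) → Deg g m → Strip E f

    bounded k f f≐n n≤k = by-gcd k f f≐n n≤k G
      (proj₂ (≉0⇒degree (proj₁ G) (∣-≉0 (proj₁ (proj₂ G)) (deg⇒≉0 f≐n))))
      where
      G : GcdIdentity f E
      G = bézout f E

    by-gcd k f {m = zero} f≐n n≤k (g , _ , _ , x , y , eq) g≐0 = record
      { factors = *-identityˡ f
      ; f₀∣E∂f₀ = _ , *-identityʳ _
      ; exponent = 0
      ; f₀∣Eᵏ = ∣-refl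
      ; f₁⊥E = let (q , qg≈1) = deg0⇒∣1 g≐0 in q * x , q * y , trans
          (solve 5 (λ q x y f E → q :* x :* f :+ q :* y :* E := q :* (x :* f :+ y :* E)) refl q x y f E)
          (trans (*-congˡ eq) qg≈1)
      }
    by-gcd zero f {m = suc m} f≐0 z≤n (g , g∣f , _) g≐m = ⊥-elim (ℕ.<⇒≱ (s≤s z≤n) (∣⇒deg≤ g∣f g≐m f≐0))
    by-gcd (suc k) f {n} {suc m} f≐n n≤1+k (g , (f′ , f′g≈f) , g∣E , _) g≐m = record
      { factors  = trans (solve 3 (λ g a b → g :* a :* b := a :* b :* g) refl g S.f₀ S.f₁)
                     (trans (*-congʳ S.factors) f′g≈f)
      ; f₀∣E∂f₀  = ∣-respʳ (*-congˡ (∂-cong (*-comm S.f₀ g))) (∣-respˡ (*-comm S.f₀ g)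
                     (∣-δ-* S.f₀∣E∂f₀ ∣-refl (∣-trans g∣E (∣-respʳ (*-comm _ E) (x∣yx E (∂ g))))))
      ; exponent = suc S.exponent
      ; f₀∣Eᵏ    = ∙-cong-∣ g∣E S.f₀∣Eᵏ
      ; f₁⊥E     = S.f₁⊥E
      }
      where
      open IsDerivation ∂-isDerivation renaming (δ-cong to ∂-cong)
      f′≐ : ∃ (Deg f′)
      f′≐ = ≉0⇒degree f′ λ f′≈0 → deg⇒≉0 f≐n (trans (sym f′g≈f) (trans (*-congʳ f′≈0) (zeroˡ g)))
      n′+m≡n : proj₁ f′≐ ℕ.+ suc m ≡ n
      n′+m≡n = deg-unique (deg-cong f′g≈f (deg-* (proj₂ f′≐) g≐m)) f≐n
      n′≤k : proj₁ f′≐ ≤ k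
      n′≤k = ℕ.≤-pred (ℕ.≤-trans (ℕ.m<m+n (proj₁ f′≐) (s≤s z≤n)) (ℕ.≤-trans (ℕ.≤-reflexive n′+m≡n) n≤1+k))
      S : Strip E f′
      S = bounded k f′ (proj₂ f′≐) n′≤k
      module S = Strip S

-- Positive characteristic and the Frobenius map.

prime>1 : ∀ {p} → Prime p → 1 < p
prime>1 {p} pp = ℕ.nonTrivial⇒n>1 p {{prime⇒nonTrivial pp}}

prime∤! : ∀ {p} → Prime p → ∀ k → k < p → ¬ (p ℕ∣.∣ k !)
prime∤! pp zero    0<p p∣1 = ℕ.<⇒≢ (prime>1 pp) (≡.sym (ℕ∣.∣1⇒≡1 p∣1))
prime∤! pp (suc k) k<p p∣k! =
  Sum.[ (λ p∣1+k → ℕ.<⇒≱ k<p (ℕ∣.∣⇒≤ p∣1+k)) , prime∤! pp k (ℕ.<-trans (ℕ.n<1+n k) k<p) ]′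
    (euclidsLemma (suc k) (k !) pp p∣k!)

prime∣C : ∀ {p k} → Prime p → 0 < k → k < p → p ℕ∣.∣ (p C k)
prime∣C {suc p} {k} pp 0<k k<p = Sum.fromInj₁
  (λ p∣k!*! → ⊥-elim (Sum.[ prime∤! pp k k<p , prime∤! pp (suc p ∸ k) p∸k<p ]′
    (euclidsLemma (k !) ((suc p ∸ k) !) pp p∣k!*!)))
  (euclidsLemma (suc p C k) (k ! ℕ.* (suc p ∸ k) !) pp
    (≡.subst (suc p ℕ∣.∣_) (≡.sym C*k!*!≡p!) (ℕ∣.m∣m*n (p !))))
  where
  p∸k<p : suc p ∸ k < suc p
  p∸k<p = ℕ.∸-monoʳ-< 0<k (ℕ.<⇒≤ k<p)
  C*k!*!≡p! : (suc p C k) ℕ.* (k ! ℕ.* (suc p ∸ k) !) ≡ suc p !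
  C*k!*!≡p! = ≡.trans (≡.cong (ℕ._* (k ! ℕ.* (suc p ∸ k) !)) (nCk≡n!/k![n-k]! (ℕ.<⇒≤ k<p)))
    (m/n*n≡m {{ℕ._!*_!≢0 k (suc p ∸ k)}} (k![n∸k]!∣n! (ℕ.<⇒≤ k<p)))

Fin-injective⇒surjective : ∀ {n} {f : Fin n → Fin n} → (∀ {i j} → f i ≡ f j → i ≡ j) → ∀ y → ∃ λ x → f x ≡ y
Fin-injective⇒surjective {suc n} {f} f-injective y with Fin.any? (λ x → f x Fin.≟ y)
... | yes hit  = hit
... | no  miss = ⊥-elim (ℕ.1+n≰n (Fin.injective⇒≤ {f = λ x → punchOut (y≢f x)}
  (λ {i} {j} eq → f-injective (Fin.punchOut-injective (y≢f i) (y≢f j) eq))))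
  where
  y≢f : ∀ x → ¬ (y ≡ f x)
  y≢f x y≡fx = miss (x , ≡.sym y≡fx)

module Characteristic {c ℓ : Level} (R : CommutativeRing c ℓ) {p : ℕ}
                      (p≈0 : CommutativeRing._≈_ R (Poly.ℕ→R R p) (CommutativeRing.0# R)) where

  open CommutativeRing R
  open Poly R using (ℕ→R)
  open import Algebra.Properties.Semiring.Mult semiring renaming (_×_ to _×ℕ_)
    using (×-congˡ; ×-homo-1; ×1-homo-*)
  open Multiples R using (×-as-*)
  open import Algebra.Properties.Monoid.Sum +-monoid using (sum; sum-cong-≋; sum-init-last; sum-replicate-zero)
  open import Algebra.Properties.Ring ring using (-‿distribˡ-*)
  open import Algebra.Properties.CommutativeSemiring.Exp commutativeSemiring using (_^_)
  open import Algebra.Properties.CommutativeSemiring.Binomial commutativeSemiring using (theorem)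
  open import Algebra.Properties.Semiring.Divisibility semiring using (_∣_; _,_)
  open import Relation.Binary.Reasoning.Setoid setoid

  ×ℕ-1 : ∀ n → n ×ℕ 1# ≈ ℕ→R n
  ×ℕ-1 zero    = refl
  ×ℕ-1 (suc n) = +-congˡ (×ℕ-1 n)

  p∣⇒×≈0 : ∀ {n} → p ℕ∣.∣ n → ∀ x → n ×ℕ x ≈ 0#
  p∣⇒×≈0 (ℕ∣.divides q ≡.refl) x = begin
    (q ℕ.* p) ×ℕ x                ≈⟨ ×-as-* (q ℕ.* p) x ⟩
    (q ℕ.* p) ×ℕ 1# * x           ≈⟨ *-congʳ (×1-homo-* q p) ⟩
    (q ×ℕ 1#) * (p ×ℕ 1#) * x     ≈⟨ *-congʳ (trans (*-congˡ (trans (×ℕ-1 p) p≈0)) (zeroʳ _)) ⟩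
    0# * x                        ≈⟨ zeroˡ x ⟩
    0#                            ∎

  -- An inverse of `n` modulo `p` becomes an inverse in the ring, where `p` is zero.
  coprime⇒×1∣1 : ∀ {n} → Coprime n p → (n ×ℕ 1#) ∣ 1#
  coprime⇒×1∣1 {n} n⊥p = from-Bézout (coprime-Bézout n⊥p)
    where
    from-Bézout : Bézout.Identity 1 n p → (n ×ℕ 1#) ∣ 1#
    from-Bézout (Bézout.+- a b 1+bp≡an) = a ×ℕ 1# , (begin
      (a ×ℕ 1#) * (n ×ℕ 1#)   ≈⟨ ×1-homo-* a n ⟨
      (a ℕ.* n) ×ℕ 1#         ≈⟨ ×-congˡ (≡.sym 1+bp≡an) ⟩
      1# + (b ℕ.* p) ×ℕ 1#    ≈⟨ trans (+-congˡ (p∣⇒×≈0 (ℕ∣.n∣m*n b) 1#)) (+-identityʳ 1#) ⟩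
      1#                      ∎)
    from-Bézout (Bézout.-+ a b 1+an≡bp) = - (a ×ℕ 1#) , (begin
      - (a ×ℕ 1#) * (n ×ℕ 1#)              ≈⟨ -‿distribˡ-* _ _ ⟨
      - ((a ×ℕ 1#) * (n ×ℕ 1#))            ≈⟨ -‿cong (×1-homo-* a n) ⟨
      - ((a ℕ.* n) ×ℕ 1#)                  ≈⟨ +-identityˡ _ ⟨
      0# + - ((a ℕ.* n) ×ℕ 1#)             ≈⟨ +-congʳ (p∣⇒×≈0 (ℕ∣.n∣m*n b) 1#) ⟨
      (b ℕ.* p) ×ℕ 1# + - ((a ℕ.* n) ×ℕ 1#) ≈⟨ +-congʳ (×-congˡ (≡.sym 1+an≡bp)) ⟩
      1# + (a ℕ.* n) ×ℕ 1# + - ((a ℕ.* n) ×ℕ 1#) ≈⟨ trans (+-assoc _ _ _) (+-congˡ (-‿inverseʳ _)) ⟩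
      1# + 0#                              ≈⟨ +-identityʳ 1# ⟩
      1#                                   ∎)

  frobenius-+ : Prime p → ∀ x y → (x + y) ^ p ≈ x ^ p + y ^ p
  frobenius-+ pp x y = go p (prime>1 pp) pp (λ q → p∣⇒×≈0 q)
    where
    -- The exponent is made a variable so that it can be a successor; the characteristic is kept as
    -- the vanishing of all multiples of `n`.
    go : ∀ n → 1 < n → Prime n → (∀ {m} → n ℕ∣.∣ m → ∀ x → m ×ℕ x ≈ 0#) → (x + y) ^ n ≈ x ^ n + y ^ n
    go (suc n) _ pn n∣⇒×≈0 = begin
      (x + y) ^ suc n                    ≈⟨ theorem (suc n) x y ⟩
      T 0 + sum t                        ≈⟨ +-cong first (sum-init-last t) ⟩
      y ^ suc n + (sum (λ i → t (inject₁ i)) + t (fromℕ n))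
        ≈⟨ +-congˡ (+-cong (trans (sum-cong-≋ middle) (sum-replicate-zero n)) last) ⟩
      y ^ suc n + (0# + x ^ suc n)       ≈⟨ +-congˡ (+-identityˡ _) ⟩
      y ^ suc n + x ^ suc n              ≈⟨ +-comm _ _ ⟩
      x ^ suc n + y ^ suc n              ∎
      where
      T : ℕ → Carrier
      T k = (suc n C k) ×ℕ (x ^ k * y ^ (suc n ∸ k))
      t : Fin (suc n) → Carrier
      t i = T (suc (toℕ i))
      first : T 0 ≈ y ^ suc n
      first = trans (×-homo-1 _) (*-identityˡ _)
      last : t (fromℕ n) ≈ x ^ suc n
      last = begin
        T (suc (toℕ (fromℕ n)))                    ≡⟨ ≡.cong (λ k → T (suc k)) (Fin.toℕ-fromℕ n) ⟩
        (suc n C suc n) ×ℕ (x ^ suc n * y ^ (n ∸ n)) ≈⟨ ×-congˡ (nCn≡1 (suc n)) ⟩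
        1 ×ℕ (x ^ suc n * y ^ (n ∸ n))             ≈⟨ ×-homo-1 _ ⟩
        x ^ suc n * y ^ (n ∸ n)                    ≡⟨ ≡.cong (λ k → x ^ suc n * y ^ k) (ℕ.n∸n≡0 n) ⟩
        x ^ suc n * 1#                             ≈⟨ *-identityʳ _ ⟩
        x ^ suc n                                  ∎
      middle : ∀ i → t (inject₁ i) ≈ 0#
      middle i = n∣⇒×≈0 (prime∣C pn (s≤s z≤n)
        (s≤s (≡.subst (_< n) (≡.sym (Fin.toℕ-inject₁ i)) (Fin.toℕ<n i)))) _

-- Vanishing derivatives and p-th powers over a finite field.

module PthRoots {c ℓ : Level} (F : CommutativeRing c ℓ)
                (isField : Poly.IsField F) (≈0? : ∀ x → Dec (CommutativeRing._≈_ F x (CommutativeRing.0# F)))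
                {p : ℕ} (p-prime : Prime p) (p≈0 : CommutativeRing._≈_ F (Poly.ℕ→R F p) (CommutativeRing.0# F))
                where

  open Poly F using (ℕ→R; HasCard)
  open Polynomials F
  open Degrees F isField ≈0?
  private module K = CommutativeRing F
  open CommutativeRing polynomialRing
  open Comaximality polynomialRing
  open PowerPart polynomialRing isBézoutDomain using (^-≉0; *-cancelʳ)
  open IsDerivation ∂-isDerivation renaming (δ-cong to ∂-cong; δ-* to ∂-*)
  open Derivation polynomialRing ∂-isDerivation renaming (δ-^ to ∂-^; δ-≈0 to ∂-≈0)
  open import Algebra.Properties.Semiring.Mult K.semiring using (×-congʳ; ×-assoc-*) renaming (_×_ to _×ᴷ_)
  open import Algebra.Properties.Semiring.Mult semiring using () renaming (_×_ to _×ℕ_)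
  open import Algebra.Properties.CommutativeSemiring.Exp commutativeSemiring
    using (_^_; ^-distrib-*)
  open import Algebra.Properties.CommutativeSemiring.Exp K.commutativeSemiring using ()
    renaming (_^_ to _^ᴷ_; ^-congˡ to ^ᴷ-congˡ)
  open import Algebra.Properties.Semiring.Divisibility semiring
    using (_∣_; _,_; ∣-respʳ; x∣yx)
  open import Algebra.Properties.CommutativeSemigroup.Divisibility *-commutativeSemigroup
    using (x∣xy)
  open import Algebra.Solver.Ring.NaturalCoefficients.Default commutativeSemiring
    using (solve; _:*_; _:=_)
  open import Relation.Binary.Reasoning.Setoid setoid

  ℕ→R-const : ∀ n → Poly.ℕ→R polynomialRing n ≈ const (ℕ→R n)
  ℕ→R-const zero    = coeffwise λ { zero → K.refl ; (suc _) → K.refl }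
  ℕ→R-const (suc n) = coeffwise λ
    { zero    → K.+-congˡ (coeff≈ (ℕ→R-const n) 0)
    ; (suc i) → K.trans (K.+-identityˡ _) (coeff≈ (ℕ→R-const n) (suc i)) }

  module CharF = Characteristic F {p} p≈0
  p≈0ᴾ : Poly.ℕ→R polynomialRing p ≈ 0#
  p≈0ᴾ = trans (ℕ→R-const p) (coeffwise λ { zero → p≈0 ; (suc _) → K.refl })

  open Characteristic polynomialRing {p} p≈0ᴾ
    using (p∣⇒×≈0; coprime⇒×1∣1; frobenius-+)

  ∤⇒coprime : ∀ {n} → ¬ (p ℕ∣.∣ n) → Coprime n p
  ∤⇒coprime p∤n {d} (d∣n , d∣p) = Sum.[ (λ d≡1 → d≡1) , (λ { ≡.refl → ⊥-elim (p∤n d∣n) }) ]′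
    (prime⇒irreducible p-prime d∣p)

  ∂≈0⇒coeff≈0 : ∀ {f} → ∂ f ≈ 0# → ∀ n → ¬ (p ℕ∣.∣ n) → coeff f n K.≈ K.0#
  ∂≈0⇒coeff≈0 {f} ∂f≈0 zero    p∤0 = ⊥-elim (p∤0 (p ℕ∣.∣0))
  ∂≈0⇒coeff≈0 {f} ∂f≈0 (suc n) p∤n = from-inverse (CharF.coprime⇒×1∣1 (∤⇒coprime p∤n))
    where
    open import Algebra.Properties.Semiring.Divisibility K.semiring using () renaming (_∣_ to _∣ᴷ_; _,_ to _,ᴷ_)
    from-inverse : (suc n ×ᴷ K.1#) ∣ᴷ K.1# → coeff f (suc n) K.≈ K.0#
    from-inverse (q ,ᴷ qn≈1) = K.trans (K.sym (K.*-identityˡ _)) (K.trans (K.*-congʳ (K.sym qn≈1))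
      (K.trans (K.*-assoc q _ _) (K.trans (K.*-congˡ (K.trans (×-assoc-* (suc n) K.1# _)
        (K.trans (×-congʳ (suc n) (K.*-identityˡ _)) (coeff≈ ∂f≈0 n)))) (K.zeroʳ q))))

  ∂≈0⇒p∣deg : ∀ {f n} → ∂ f ≈ 0# → Deg f n → p ℕ∣.∣ n
  ∂≈0⇒p∣deg {f} {n} ∂f≈0 f≐n with p ℕ∣.∣? n
  ... | yes p∣n = p∣n
  ... | no  p∤n = ⊥-elim (leading≉0 f≐n (∂≈0⇒coeff≈0 ∂f≈0 n p∤n))

  -- A nonzero derivative has smaller degree than `f`, so `f` cannot divide it.
  ∣∂⇒∂≈0 : ∀ f → f ∣ ∂ f → ∂ f ≈ 0#
  ∣∂⇒∂≈0 f f∣∂f = Sum.[ (λ ∂f≈0 → ∂f≈0) , (λ (k , ∂f≐k) → ⊥-elim (nonzero ∂f≐k (degree f))) ]′ (degree (∂ f))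
    where
    nonzero : ∀ {k} → Deg (∂ f) k → ¬ (f ≈ 0# ⊎ ∃ (Deg f))
    nonzero ∂f≐k (inj₁ f≈0) = deg⇒≉0 ∂f≐k (∂-≈0 f≈0)
    nonzero ∂f≐k (inj₂ (n , f≐n)) = ℕ.<⇒≱
      (deg-minimal (deg-* deg-X ∂f≐k) (∂-degLe f (degLe f≐n))) (∣⇒deg≤ f∣∂f f≐n ∂f≐k)

  -- By coprimality `u` divides its own derivative, and so does `v`. Thus a vanishing derivative of
  -- the fraction `u / v` passes to numerator and denominator separately.
  wronskian≈0⇒∂≈0 : ∀ {u v} → u ⊥ v → u * ∂ v ≈ ∂ u * v → ∂ u ≈ 0# × ∂ v ≈ 0#
  wronskian≈0⇒∂≈0 {u} {v} u⊥v eq =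
    ∣∂⇒∂≈0 u (⊥-gauss u⊥v (∣-respʳ (trans eq (*-comm _ _)) (x∣xy u (∂ v)))) ,
    ∣∂⇒∂≈0 v (⊥-gauss (⊥-sym u⊥v) (∣-respʳ (sym eq) (x∣yx v (∂ u))))

  ∂-^p : ∀ f → ∂ (f ^ p) ≈ 0#
  ∂-^p f = go p (prime>1 p-prime) (p∣⇒×≈0 ℕ∣.∣-refl)
    where
    go : ∀ n → 1 < n → (∀ g → n ×ℕ g ≈ 0#) → ∂ (f ^ n) ≈ 0#
    go (suc n) _ n×≈0 = trans (∂-^ f n) (n×≈0 _)

  0^p≈0 : 0# ^ p ≈ 0#
  0^p≈0 = go p (ℕ.<⇒≤ (prime>1 p-prime))
    where
    go : ∀ n → 0 < n → 0# ^ n ≈ 0#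
    go (suc n) _ = zeroˡ _

  -- `p`-th powers are constants of `∂`, so the relation is differentiated with `a ^ p` and `b ^ p`
  -- as scalars; the factor `b ^ p` is then cancelled.
  pth-power⇒wronskian≈0 : ∀ {u v a b} → ¬ (b ≈ 0#) → u * b ^ p ≈ v * a ^ p → u * ∂ v ≈ ∂ u * v
  pth-power⇒wronskian≈0 {u} {v} {a} {b} b≉0 eq = *-cancelʳ (^-≉0 p b≉0) (begin
    u * ∂ v * b ^ p       ≈⟨ solve 3 (λ u v b → u :* v :* b := v :* (u :* b)) refl u (∂ v) (b ^ p) ⟩
    ∂ v * (u * b ^ p)     ≈⟨ *-congˡ eq ⟩
    ∂ v * (v * a ^ p)     ≈⟨ solve 3 (λ x v a → x :* (v :* a) := v :* (x :* a)) refl (∂ v) v (a ^ p) ⟩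
    v * (∂ v * a ^ p)     ≈⟨ *-congˡ (∂-*ᵖ v a) ⟨
    v * ∂ (v * a ^ p)     ≈⟨ *-congˡ (∂-cong eq) ⟨
    v * ∂ (u * b ^ p)     ≈⟨ *-congˡ (∂-*ᵖ u b) ⟩
    v * (∂ u * b ^ p)     ≈⟨ solve 3 (λ v u b → v :* (u :* b) := u :* v :* b) refl v (∂ u) (b ^ p) ⟩
    ∂ u * v * b ^ p       ∎)
    where
    ∂-*ᵖ : ∀ f g → ∂ (f * g ^ p) ≈ ∂ f * g ^ p
    ∂-*ᵖ f g = trans (∂-* f (g ^ p)) (trans (+-congˡ (trans (*-congˡ (∂-^p g)) (zeroʳ f))) (+-identityʳ _))

  K-frobenius-injective : ∀ {x y} → x ^ᴷ p K.≈ y ^ᴷ p → x K.≈ y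
  K-frobenius-injective {x} {y} eq with ≈0? (x K.+ K.- y)
  ... | yes x-y≈0 = x∙y⁻¹≈ε⇒x≈y x y x-y≈0
    where open import Algebra.Properties.Group K.+-group using (x∙y⁻¹≈ε⇒x≈y)
  ... | no  x-y≉0 = ⊥-elim (K-^-≉0 p (+-identityˡ-unique ((x K.+ K.- y) ^ᴷ p) (y ^ᴷ p)
    (K.trans (K.sym (CharF.frobenius-+ p-prime (x K.+ K.- y) y))
      (K.trans (^ᴷ-congˡ p (K.trans (K.+-assoc x _ y) (K.trans (K.+-congˡ (K.-‿inverseˡ y)) (K.+-identityʳ x)))) eq))))
    where
    open import Algebra.Properties.Ring K.ring using (+-identityˡ-unique)
    K-^-≉0 : ∀ n → ¬ ((x K.+ K.- y) ^ᴷ n K.≈ K.0#)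
    K-^-≉0 zero    = proj₁ isField
    K-^-≉0 (suc n) = K-*-≉0 x-y≉0 (K-^-≉0 n)

  module _ {q : ℕ} (card : HasCard q) where

    open import Function.Bundles using (module Bijection)
    private module Card = Bijection card

    -- Along the enumeration by `Fin q`, Frobenius is an injective self-map of a finite set. This
    -- supplies the `p`-th roots of coefficients.
    K-frobenius-surjective : ∀ x → ∃ λ y → y ^ᴷ p K.≈ x
    K-frobenius-surjective x = Card.to (proj₁ preimage) , K.trans (K.sym (proj₂ (index _)))
      (K.trans (K.reflexive (≡.cong Card.to (proj₂ preimage))) (proj₂ (index x)))
      where
      index : ∀ x → ∃ λ i → Card.to i K.≈ x
      index = Card.strictlySurjective
      φ : Fin q → Fin q
      φ i = proj₁ (index (Card.to i ^ᴷ p))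
      φ-injective : ∀ {i j} → φ i ≡ φ j → i ≡ j
      φ-injective {i} {j} eq = Card.injective (K-frobenius-injective
        (K.trans (K.sym (proj₂ (index _))) (K.trans (K.reflexive (≡.cong Card.to eq)) (proj₂ (index _)))))
      preimage : ∃ λ i → φ i ≡ proj₁ (index x)
      preimage = Fin-injective⇒surjective φ-injective (proj₁ (index x))

    const-^ : ∀ x n → const x ^ n ≈ const (x ^ᴷ n)
    const-^ x zero    = coeffwise λ { zero → K.refl ; (suc _) → K.refl }
    const-^ x (suc n) = trans (*-congˡ (const-^ x n)) (coeffwise λ
      { zero    → K.refl
      ; (suc i) → K.trans (*ₚ-tail (coeff (const x)) (coeff (const (x ^ᴷ n))) i)
          (K.trans (K.+-cong (K.zeroʳ x) (*ₚ-zeroˡ (coeff (const (x ^ᴷ n))) i)) (K.+-identityˡ K.0#)) })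

    drop : ℕ → Polynomial → Polynomial
    coeff  (drop k f) n = coeff f (n ℕ.+ k)
    isPoly (drop k f) = proj₁ (isPoly f) , λ n N≤n → proj₂ (isPoly f) (n ℕ.+ k) (ℕ.≤-trans N≤n (ℕ.m≤m+n n k))

    pth-root-expansion : ∀ f → (∀ n → ¬ (p ℕ∣.∣ n) → coeff f n K.≈ K.0#) →
                         const (coeff f 0) + X ^ p * drop p f ≈ f
    pth-root-expansion f f≈0 = coeffwise at
      where
      g = drop p f
      at : ∀ n → coeff (const (coeff f 0) + X ^ p * g) n K.≈ coeff f n
      at n with n ℕ.<? p
      at zero    | yes 0<p = K.trans (K.+-congˡ (coeff-X^*-low p g 0<p)) (K.+-identityʳ _)
      at (suc n) | yes n<p = K.trans (K.+-congˡ (coeff-X^*-low p g n<p)) (K.trans (K.+-identityʳ _)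
        (K.sym (f≈0 (suc n) (λ p∣n → ℕ.<⇒≱ n<p (ℕ∣.∣⇒≤ p∣n)))))
      at n       | no  n≮p with ℕ.m≤n⇒∃[o]m+o≡n (ℕ.≮⇒≥ n≮p)
      ... | o , ≡.refl = K.trans (K.+-cong (degLe-const (coeff f 0) (p ℕ.+ o) (ℕ.≤-trans (ℕ.<⇒≤ (prime>1 p-prime)) (ℕ.m≤m+n p o)))
          (coeff-X^*-high p g o))
        (K.trans (K.+-identityˡ _) (K.reflexive (≡.cong (coeff f) (ℕ.+-comm o p))))

    -- Such an `f` is a polynomial in t^p. Its constant term has a `p`-th root `b` in the field; the
    -- rest is t^p times a shifted polynomial of the same kind, with root `h`. Frobenius is
    -- additive, so `b + t h` is a root of `f`. A shift by `p` lowers the vanishing bound by at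
    -- least one, which ends the recursion.
    pth-root : ∀ f → (∀ n → ¬ (p ℕ∣.∣ n) → coeff f n K.≈ K.0#) → ∃ λ h → h ^ p ≈ f
    pth-root f f≈0 = bounded (proj₁ (isPoly f)) f (proj₂ (isPoly f)) f≈0
      where
      bounded : ∀ N f → (∀ n → N ≤ n → coeff f n K.≈ K.0#) →
                (∀ n → ¬ (p ℕ∣.∣ n) → coeff f n K.≈ K.0#) → ∃ λ h → h ^ p ≈ f
      bounded zero f small _ = 0# , trans 0^p≈0 (coeffwise λ n → K.sym (small n z≤n))
      bounded (suc N) f small f≈0 = const b + X * h , (begin
        (const b + X * h) ^ p                    ≈⟨ frobenius-+ p-prime (const b) (X * h) ⟩
        const b ^ p + (X * h) ^ p                ≈⟨ +-cong (const-^ b p) (^-distrib-* X h p) ⟩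
        const (b ^ᴷ p) + X ^ p * h ^ p           ≈⟨ +-cong (coeffwise λ { zero → bᵖ≈f₀ ; (suc _) → K.refl }) (*-congˡ hᵖ≈) ⟩
        const (coeff f 0) + X ^ p * drop p f     ≈⟨ pth-root-expansion f f≈0 ⟩
        f                                        ∎)
        where
        b : K.Carrier
        b = proj₁ (K-frobenius-surjective (coeff f 0))
        bᵖ≈f₀ : b ^ᴷ p K.≈ coeff f 0
        bᵖ≈f₀ = proj₂ (K-frobenius-surjective (coeff f 0))
        rest : ∃ λ h → h ^ p ≈ drop p f
        rest = bounded N (drop p f)
          (λ n N≤n → small (n ℕ.+ p) (ℕ.≤-trans (s≤s N≤n) (ℕ.≤-trans (ℕ.≤-reflexive (ℕ.+-comm 1 n))
            (ℕ.+-monoʳ-≤ n (ℕ.<⇒≤ (prime>1 p-prime))))))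
          (λ n p∤n → f≈0 (n ℕ.+ p) λ p∣n+p → p∤n (ℕ∣.∣m+n∣m⇒∣n (≡.subst (p ℕ∣.∣_) (ℕ.+-comm n p) p∣n+p) ℕ∣.∣-refl))
        h : Polynomial
        h = proj₁ rest
        hᵖ≈ : h ^ p ≈ drop p f
        hᵖ≈ = proj₂ rest

-- Height inequalities for points on the curve.

height-arithmetic : ∀ ρ σ μ {a b e k} → b ≤ a → suc (σ ℕ.* a ℕ.+ e) ≤ b ℕ.+ k → k ≤ suc σ ℕ.* a →
  ρ ℕ.* (a ℕ.+ b ℕ.+ k) ≤ suc ρ ℕ.* e ℕ.+ ρ ℕ.* suc (suc μ) →
  a ℕ.* (ρ ℕ.* suc σ) < 2 ℕ.* a ℕ.+ ρ ℕ.* suc μ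
height-arithmetic ρ σ μ {a} {b} {e} {k} b≤a wronskian≤ k≤ ramification≤ =
  -- Here `a` and `b` are the larger and the smaller of the degrees of `u` and `v`, and `e` and `k`
  -- those of `W` and `A`. The Wronskian inequality is taken `suc ρ` times, which eliminates `e`;
  -- the others are taken once. The `suc ρ` units from the degree drop of the derivative exceed by
  -- one the `ρ` units contributed by the factor t of `E`, and this makes the result strict.
  ℕ.+-cancelʳ-≤ slack _ _ (ℕ.≤-trans (ℕ.≤-reflexive left) (ℕ.≤-trans
    (ℕ.+-mono-≤ (ℕ.+-mono-≤ (ℕ.+-mono-≤ ramification≤ (ℕ.*-monoʳ-≤ (suc ρ) wronskian≤)) k≤) b≤a)
    (ℕ.≤-reflexive right)))
  where
  open +-*-Solver
  slack : ℕ
  slack = ρ ℕ.* b ℕ.+ ρ ℕ.* k ℕ.+ suc ρ ℕ.* e ℕ.+ ρ ℕ.+ σ ℕ.* a ℕ.+ k ℕ.+ b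
  left : suc (a ℕ.* (ρ ℕ.* suc σ)) ℕ.+ slack ≡
         ρ ℕ.* (a ℕ.+ b ℕ.+ k) ℕ.+ suc ρ ℕ.* suc (σ ℕ.* a ℕ.+ e) ℕ.+ k ℕ.+ b
  left = solve 6 (λ ρ σ a b e k →
    con 1 :+ a :* (ρ :* (con 1 :+ σ)) :+ (ρ :* b :+ ρ :* k :+ (con 1 :+ ρ) :* e :+ ρ :+ σ :* a :+ k :+ b)
    := ρ :* (a :+ b :+ k) :+ (con 1 :+ ρ) :* (con 1 :+ (σ :* a :+ e)) :+ k :+ b) ≡.refl ρ σ a b e k
  right : suc ρ ℕ.* e ℕ.+ ρ ℕ.* suc (suc μ) ℕ.+ suc ρ ℕ.* (b ℕ.+ k) ℕ.+ suc σ ℕ.* a ℕ.+ a ≡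
          2 ℕ.* a ℕ.+ ρ ℕ.* suc μ ℕ.+ slack
  right = solve 7 (λ ρ σ μ a b e k →
    (con 1 :+ ρ) :* e :+ ρ :* (con 2 :+ μ) :+ (con 1 :+ ρ) :* (b :+ k) :+ (con 1 :+ σ) :* a :+ a
    := con 2 :* a :+ ρ :* (con 1 :+ μ) :+ (ρ :* b :+ ρ :* k :+ (con 1 :+ ρ) :* e :+ ρ :+ σ :* a :+ k :+ b))
    ≡.refl ρ σ μ a b e k

twice-product : ∀ d s → d ℕ.* s ℕ.+ d ℕ.* s ≡ s ℕ.* (2 ℕ.* d)
twice-product = solve 2 (λ d s → d :* s :+ d :* s := s :* (con 2 :* d)) ≡.refl
  where open +-*-Solver

module Curve {c ℓ : Level} (F : CommutativeRing c ℓ)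
             (isField : Poly.IsField F) (≈0? : ∀ x → Dec (CommutativeRing._≈_ F x (CommutativeRing.0# F)))
             where

  open Poly F using (DegLe)
  open Polynomials F
  open Degrees F isField ≈0?
  open CommutativeRing polynomialRing
  open Comaximality polynomialRing
  open IsBézoutDomain isBézoutDomain using (1≉0)
  open PowerPart polynomialRing isBézoutDomain
  open IsDerivation ∂-isDerivation renaming (δ-cong to ∂-cong; δ-+ to ∂-+; δ-* to ∂-*)
  open Derivation polynomialRing ∂-isDerivation renaming (δ-^ to ∂-^; δ-1 to ∂-1; δ-≈0 to ∂-≈0)
  open import Algebra.Properties.Semiring.Mult semiring renaming (_×_ to _×ℕ_)
  open Multiples polynomialRing using (×-as-*)
  open import Algebra.Properties.CommutativeSemiring.Exp commutativeSemiring
    using (_^_; ^-congˡ; ^-distrib-*)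
  open import Algebra.Properties.Semiring.Divisibility semiring
    using (_∣_; _∥_; _,_; ∣-trans; ∣-respʳ; ∣-respˡ; ∣-refl; x∣yx)
  open import Algebra.Properties.CommutativeSemigroup.Divisibility *-commutativeSemigroup
    using (∙-cong-∣; x∣xy)
  open import Algebra.Properties.Ring ring using (-1*x≈-x; -‿involutive)
  open import Algebra.Solver.Ring.NaturalCoefficients.Default commutativeSemiring
    using (solve; _:+_; _:*_; _:=_)
  open import Relation.Binary.Reasoning.Setoid setoid

  ∂-^′ : ∀ f n → ∂ (f ^ suc n) ≈ suc n ×ℕ 1# * (f ^ n * ∂ f)
  ∂-^′ f n = trans (∂-^ f n) (×-as-* (suc n) (f ^ n * ∂ f))

  ∂-^-zero : ∀ {f} n → ∂ f ≈ 0# → ∂ (f ^ n) ≈ 0#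
  ∂-^-zero zero ∂f≈0 = ∂-1
  ∂-^-zero {f} (suc n) ∂f≈0 = trans (∂-^′ f n)
    (trans (*-congˡ (trans (*-congˡ ∂f≈0) (zeroʳ _))) (zeroʳ _))

  -- This is the derivative of x^s + 1, which is `A` over the s-th power of `v`, multiplied out: the
  -- derivative of x is `W` over the square of `v`. The shape is the relation that `ramification`
  -- expects.
  wronskian-powers : ∀ σ {u v W} → u * ∂ v + W ≈ ∂ u * v →
    suc σ ×ℕ 1# * ∂ v * (u ^ suc σ + v ^ suc σ) + suc σ ×ℕ 1# * u ^ σ * W ≈ v * ∂ (u ^ suc σ + v ^ suc σ)
  wronskian-powers σ {u} {v} {W} W-def = begin
    s * ∂ v * (u ^ suc σ + v ^ suc σ) + s * u ^ σ * W
      ≈⟨ solve 7 (λ s u v u^ v^ v′ w → s :* v′ :* (u :* u^ :+ v :* v^) :+ s :* u^ :* w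
           := s :* (u^ :* (u :* v′ :+ w)) :+ v :* (s :* (v^ :* v′))) refl s u v (u ^ σ) (v ^ σ) (∂ v) W ⟩
    s * (u ^ σ * (u * ∂ v + W)) + v * (s * (v ^ σ * ∂ v))
      ≈⟨ +-congʳ (*-congˡ (*-congˡ W-def)) ⟩
    s * (u ^ σ * (∂ u * v)) + v * (s * (v ^ σ * ∂ v))
      ≈⟨ solve 6 (λ s v u^ v^ u′ v′ → s :* (u^ :* (u′ :* v)) :+ v :* (s :* (v^ :* v′))
           := v :* (s :* (u^ :* u′) :+ s :* (v^ :* v′))) refl s v (u ^ σ) (v ^ σ) (∂ u) (∂ v) ⟩
    v * (s * (u ^ σ * ∂ u) + s * (v ^ σ * ∂ v))
      ≈⟨ *-congˡ (+-cong (∂-^′ u σ) (∂-^′ v σ)) ⟨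
    v * (∂ (u ^ suc σ) + ∂ (v ^ suc σ))
      ≈⟨ *-congˡ (∂-+ (u ^ suc σ) (v ^ suc σ)) ⟨
    v * ∂ (u ^ suc σ + v ^ suc σ) ∎
    where
    s : Polynomial
    s = suc σ ×ℕ 1#

  -- `wronskian-powers` multiplied by t is solved for the term in `W`. The operator t d/dt does not
  -- raise degrees, so the other two terms stay below `b + k`, while the term in `W` gains one from
  -- the factor t.
  wronskian-degree : ∀ σ {u v W a b e} k → (suc σ ×ℕ 1#) ∣ 1# → u * ∂ v + W ≈ ∂ u * v →
    Deg u a → Deg v b → Deg W e → Deg (u ^ suc σ + v ^ suc σ) k → suc (σ ℕ.* a ℕ.+ e) ≤ b ℕ.+ k
  wronskian-degree σ {u} {v} {W} {a} {b} {e} k s∣1 W-def u≐a v≐b W≐e A≐k =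
    deg-minimal (deg-* deg-X (deg-* (deg-* s≐0 (deg-^ σ u≐a)) W≐e))
      (degLe-cong {v * (X * ∂ A) + - (s * (X * ∂ v) * A)} (sym X*W) (degLe-+ {v * (X * ∂ A)} {g = - (s * (X * ∂ v) * A)}
        (degLe-* v (X * ∂ A) (degLe v≐b) (∂-degLe A (degLe A≐k)))
        (degLe-neg (s * (X * ∂ v) * A) (degLe-* (s * (X * ∂ v)) A
          (degLe-* s (X * ∂ v) {0} (degLe s≐0) (∂-degLe v (degLe v≐b))) (degLe A≐k)))))
    where
    s A : Polynomial
    s = suc σ ×ℕ 1#
    A = u ^ suc σ + v ^ suc σ
    s≐0 : Deg s 0
    s≐0 = ∣1⇒deg0 s∣1
    X*W : X * (s * u ^ σ * W) ≈ v * (X * ∂ A) + - (s * (X * ∂ v) * A)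
    X*W = begin
      X * (s * u ^ σ * W)
        ≈⟨ trans (+-congˡ (-‿inverseʳ _)) (+-identityʳ _) ⟨
      X * (s * u ^ σ * W) + (s * (X * ∂ v) * A + - (s * (X * ∂ v) * A))
        ≈⟨ +-assoc _ _ _ ⟨
      X * (s * u ^ σ * W) + s * (X * ∂ v) * A + - (s * (X * ∂ v) * A)
        ≈⟨ +-congʳ (solve 6 (λ x s u w v a → x :* (s :* u :* w) :+ s :* (x :* v) :* a
             := x :* (s :* v :* a :+ s :* u :* w)) refl X s (u ^ σ) W (∂ v) A) ⟩
      X * (s * ∂ v * A + s * u ^ σ * W) + - (s * (X * ∂ v) * A)
        ≈⟨ +-congʳ (*-congˡ (wronskian-powers σ W-def)) ⟩
      X * (v * ∂ A) + - (s * (X * ∂ v) * A)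
        ≈⟨ +-congʳ (solve 3 (λ x v a → x :* (v :* a) := v :* (x :* a)) refl X v (∂ A)) ⟩
      v * (X * ∂ A) + - (s * (X * ∂ v) * A) ∎

  -- The exponents of the curve are r = ρ + 1, s = σ + 1 and ds = μ + 1.
  module _ (ρ σ μ : ℕ) (r⊥s : Coprime (suc ρ) (suc σ))
           (s∣1 : (suc σ ×ℕ 1#) ∣ 1#)
           {u v w z : Polynomial} (v≉0 : ¬ (v ≈ 0#)) (z≉0 : ¬ (z ≈ 0#)) (u≉0 : ¬ (u ≈ 0#)) (u⊥v : u ⊥ v)
           (on-curve : w ^ suc ρ * u ^ suc σ * v ^ suc σ ≈
              z ^ suc ρ * (u ^ suc σ + v ^ suc σ) * (u ^ suc σ + X ^ suc μ * v ^ suc σ))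
           where

    uˢ vˢ tᵐ A B D E : Polynomial
    uˢ = u ^ suc σ
    vˢ = v ^ suc σ
    tᵐ = X ^ suc μ
    A = uˢ + vˢ
    B = uˢ + tᵐ * vˢ
    D = tᵐ + - 1#
    E = X * D

    D≐ : Deg D (suc μ)
    D≐ = deg-+ (deg-X^ (suc μ)) (degLe (deg-neg deg-1)) (s≤s z≤n)

    f∣fˢ : ∀ f → f ∣ f ^ suc σ
    f∣fˢ f = x∣xy f (f ^ σ)

    u⊥A : u ⊥ A
    u⊥A = ⊥-sumʳ (⊥-^ʳ (suc σ) u⊥v) (f∣fˢ u) refl

    v⊥A : v ⊥ A
    v⊥A = ⊥-sumʳ (⊥-^ʳ (suc σ) (⊥-sym u⊥v)) (f∣fˢ v) (+-comm vˢ uˢ)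

    v⊥B : v ⊥ B
    v⊥B = ⊥-sumʳ (⊥-^ʳ (suc σ) (⊥-sym u⊥v)) (∣-trans (f∣fˢ v) (x∣yx vˢ tᵐ)) (+-comm _ uˢ)

    A+Dvˢ≈B : A + D * vˢ ≈ B
    A+Dvˢ≈B = begin
      uˢ + vˢ + (tᵐ + - 1#) * vˢ
        ≈⟨ +-congˡ (trans (distribʳ vˢ tᵐ (- 1#)) (+-congˡ (-1*x≈-x vˢ))) ⟩
      uˢ + vˢ + (tᵐ * vˢ + - vˢ)
        ≈⟨ solve 4 (λ a b c d → a :+ b :+ (c :+ d) := a :+ c :+ (b :+ d)) refl uˢ vˢ (tᵐ * vˢ) (- vˢ) ⟩
      uˢ + tᵐ * vˢ + (vˢ + - vˢ)
        ≈⟨ trans (+-congˡ (-‿inverseʳ vˢ)) (+-identityʳ _) ⟩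
      uˢ + tᵐ * vˢ ∎

    ⊥E⇒⊥X : ∀ {f} → f ⊥ E → f ⊥ X
    ⊥E⇒⊥X = ⊥-∣ʳ (x∣xy X D)

    ⊥E⇒⊥D : ∀ {f} → f ⊥ E → f ⊥ D
    ⊥E⇒⊥D = ⊥-∣ʳ (x∣yx D X)

    module _ {f} (S : Strip E f) where
      open Strip S

      f₁∣f : f₁ ∣ f
      f₁∣f = f₀ , factors

      f₁⊥f₀ : f₁ ⊥ f₀
      f₁⊥f₀ = ⊥-∣ʳ f₀∣Eᵏ (⊥-^ʳ exponent f₁⊥E)

      f₁≉0 : ¬ (f ≈ 0#) → ¬ (f₁ ≈ 0#)
      f₁≉0 = ∣-≉0 f₁∣f

    -- `u` enters the equation to the power s, and coprimality of r and s removes that exponent.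
    -- Away from t the factor is coprime to `B`, which is tᵐ vˢ modulo `u`; at t = 0 they may meet.
    u₁-power : (S : Strip E u) → ∃ λ β → Strip.f₁ S ∥ β ^ suc ρ
    u₁-power S = power-part-^ (suc ρ) (suc σ) {w} {z} {f₁} {f₀ ^ suc σ * vˢ} {A * B} r⊥s (f₁≉0 S u≉0) (inj₂ z≉0)
      (⊥-*ʳ (⊥-^ʳ (suc σ) (f₁⊥f₀ S)) f₁⊥vˢ)
      (⊥-*ʳ (⊥-∣ˡ (f₁∣f S) u⊥A)
        (⊥-sumʳ (⊥-*ʳ (⊥-^ʳ (suc μ) (⊥E⇒⊥X f₁⊥E)) f₁⊥vˢ) (∣-trans (f₁∣f S) (f∣fˢ u)) refl))
      (begin
        w ^ suc ρ * (f₁ ^ suc σ * (f₀ ^ suc σ * vˢ))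
          ≈⟨ solve 4 (λ w a b v → w :* (a :* (b :* v))
               := w :* (b :* a) :* v) refl (w ^ suc ρ) (f₁ ^ suc σ) (f₀ ^ suc σ) vˢ ⟩
        w ^ suc ρ * (f₀ ^ suc σ * f₁ ^ suc σ) * vˢ
          ≈⟨ *-congʳ (*-congˡ (trans (sym (^-distrib-* f₀ f₁ (suc σ))) (^-congˡ (suc σ) factors))) ⟩
        w ^ suc ρ * uˢ * vˢ
          ≈⟨ trans on-curve (*-assoc _ A B) ⟩
        z ^ suc ρ * (A * B) ∎)
      where
      open Strip S
      f₁⊥vˢ : f₁ ⊥ vˢ
      f₁⊥vˢ = ⊥-^ʳ (suc σ) (⊥-∣ˡ (f₁∣f S) u⊥v)

    v₁-power : (S : Strip E v) → ∃ λ β → Strip.f₁ S ∥ β ^ suc ρ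
    v₁-power S = power-part-^ (suc ρ) (suc σ) {w} {z} {f₁} {f₀ ^ suc σ * uˢ} {A * B} r⊥s (f₁≉0 S v≉0) (inj₂ z≉0)
      (⊥-*ʳ (⊥-^ʳ (suc σ) (f₁⊥f₀ S)) (⊥-^ʳ (suc σ) (⊥-∣ˡ (f₁∣f S) (⊥-sym u⊥v))))
      (⊥-*ʳ (⊥-∣ˡ (f₁∣f S) v⊥A) (⊥-∣ˡ (f₁∣f S) v⊥B))
      (begin
        w ^ suc ρ * (f₁ ^ suc σ * (f₀ ^ suc σ * uˢ))
          ≈⟨ solve 4 (λ w a b u → w :* (a :* (b :* u))
               := w :* u :* (b :* a)) refl (w ^ suc ρ) (f₁ ^ suc σ) (f₀ ^ suc σ) uˢ ⟩
        w ^ suc ρ * uˢ * (f₀ ^ suc σ * f₁ ^ suc σ)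
          ≈⟨ *-congˡ (trans (sym (^-distrib-* f₀ f₁ (suc σ))) (^-congˡ (suc σ) factors)) ⟩
        w ^ suc ρ * uˢ * vˢ
          ≈⟨ trans on-curve (*-assoc _ A B) ⟩
        z ^ suc ρ * (A * B) ∎)
      where open Strip S

    -- Modulo `A` the factor `B` is `D * vˢ`, so `A` and `B` can meet only at zeros of `D`, which
    -- `f₁` avoids.
    A₁-power : ¬ (A ≈ 0#) → (S : Strip E A) → ∃ λ β → Strip.f₁ S ∥ β ^ suc ρ
    A₁-power A≉0 S = power-part (suc ρ) {z} {w} {f₁} {f₀ * B} {uˢ * vˢ} (f₁≉0 S A≉0) (inj₁ z≉0)
      (⊥-*ʳ (f₁⊥f₀ S) (⊥-sumʳ (⊥-*ʳ (⊥E⇒⊥D f₁⊥E) f₁⊥vˢ) (f₁∣f S) A+Dvˢ≈B))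
      (⊥-*ʳ (⊥-^ʳ (suc σ) (⊥-∣ˡ (f₁∣f S) (⊥-sym u⊥A))) f₁⊥vˢ)
      (begin
        z ^ suc ρ * (f₁ * (f₀ * B))
          ≈⟨ solve 4 (λ z a b c → z :* (a :* (b :* c))
               := z :* (b :* a) :* c) refl (z ^ suc ρ) f₁ f₀ B ⟩
        z ^ suc ρ * (f₀ * f₁) * B    ≈⟨ *-congʳ (*-congˡ factors) ⟩
        z ^ suc ρ * A * B            ≈⟨ trans (sym on-curve) (*-assoc _ uˢ vˢ) ⟩
        w ^ suc ρ * (uˢ * vˢ)        ∎)
      where
      open Strip S
      f₁⊥vˢ : f₁ ⊥ vˢ
      f₁⊥vˢ = ⊥-^ʳ (suc σ) (⊥-∣ˡ (f₁∣f S) (⊥-sym v⊥A))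

    B₁-power : ¬ (B ≈ 0#) → (S : Strip E B) → ∃ λ β → Strip.f₁ S ∥ β ^ suc ρ
    B₁-power B≉0 S = power-part (suc ρ) {z} {w} {f₁} {f₀ * A} {uˢ * vˢ} (f₁≉0 S B≉0) (inj₁ z≉0)
      (⊥-*ʳ (f₁⊥f₀ S) f₁⊥A)
      (⊥-*ʳ f₁⊥uˢ f₁⊥vˢ)
      (begin
        z ^ suc ρ * (f₁ * (f₀ * A))
          ≈⟨ solve 4 (λ z a b c → z :* (a :* (b :* c))
               := z :* c :* (b :* a)) refl (z ^ suc ρ) f₁ f₀ A ⟩
        z ^ suc ρ * A * (f₀ * f₁)    ≈⟨ *-congˡ factors ⟩
        z ^ suc ρ * A * B            ≈⟨ trans (sym on-curve) (*-assoc _ uˢ vˢ) ⟩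
        w ^ suc ρ * (uˢ * vˢ)        ∎)
      where
      open Strip S
      f₁⊥vˢ : f₁ ⊥ vˢ
      f₁⊥vˢ = ⊥-^ʳ (suc σ) (⊥-∣ˡ (f₁∣f S) (⊥-sym v⊥B))
      f₁⊥tᵐvˢ : f₁ ⊥ tᵐ * vˢ
      f₁⊥tᵐvˢ = ⊥-*ʳ (⊥-^ʳ (suc μ) (⊥E⇒⊥X f₁⊥E)) f₁⊥vˢ
      -- Modulo `B`, hence modulo its divisor `f₁`, the summands `f` and `g` are negatives of each
      -- other.
      ⊥-difference : ∀ {f g} → f₁ ⊥ g → f + g ≈ B → f₁ ⊥ f
      ⊥-difference {f} {g} f₁⊥g f+g≈B = ⊥-∣ʳ (- 1# , (begin
        - 1# * f      ≈⟨ -1*x≈-x f ⟩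
        - f           ≈⟨ trans (sym (+-identityʳ _)) (+-congˡ (sym (-‿inverseʳ B))) ⟩
        - f + (B + - B)  ≈⟨ +-congˡ (+-congʳ (sym f+g≈B)) ⟩
        - f + (f + g + - B)
          ≈⟨ solve 4 (λ m f g b → m :+ (f :+ g :+ b) := (f :+ m) :+ (b :+ g)) refl (- f) f g (- B) ⟩
        f + - f + (- B + g) ≈⟨ trans (+-congʳ (-‿inverseʳ f)) (+-identityˡ _) ⟩
        - B + g       ∎))
        (⊥-sumʳ f₁⊥g (∣-trans (f₁∣f S) (- 1# , -1*x≈-x B)) refl)
      f₁⊥uˢ : f₁ ⊥ uˢ
      f₁⊥uˢ = ⊥-difference f₁⊥tᵐvˢ refl
      f₁⊥A : f₁ ⊥ A
      f₁⊥A = ⊥-difference (⊥-*ʳ (⊥E⇒⊥D f₁⊥E) f₁⊥vˢ) A+Dvˢ≈B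

    module _ {W} (W-def : u * ∂ v + W ≈ ∂ u * v) (W≉0 : ¬ (W ≈ 0#)) where

      A≉0 : ¬ (A ≈ 0#)
      A≉0 A≈0 = *-≉0 (*-≉0 (∣-≉0 s∣1 1≉0) (^-≉0 σ u≉0)) W≉0 (begin
        s * u ^ σ * W                      ≈⟨ +-identityˡ _ ⟨
        0# + s * u ^ σ * W                 ≈⟨ +-congʳ (trans (*-congˡ A≈0) (zeroʳ _)) ⟨
        s * ∂ v * A + s * u ^ σ * W        ≈⟨ wronskian-powers σ W-def ⟩
        v * ∂ A                            ≈⟨ *-congˡ (∂-≈0 A≈0) ⟩
        v * 0#                             ≈⟨ zeroʳ v ⟩
        0#                                 ∎)
        where
        s : Polynomial
        s = suc σ ×ℕ 1#

      -- Each of `u`, `v`, `A` satisfies a relation `k f + m W = l f′` with `m` coprime to `f`: here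
      -- `m` is 1, -1 and `s u^σ` respectively. Pairwise coprimality multiplies the three
      -- divisibilities.
      ramification-divides : (u * v * A) ^ ρ ∣ W ^ suc ρ * E ^ ρ
      ramification-divides = ∣-respˡ
        (sym (trans (^-distrib-* (u * v) A ρ) (*-congʳ (^-distrib-* u v ρ))))
        (⊥-*-∣ (⊥-*ˡ (⊥-^ʳ ρ (⊥-^ˡ ρ u⊥A)) (⊥-^ʳ ρ (⊥-^ˡ ρ v⊥A)))
          (⊥-*-∣ (⊥-^ʳ ρ (⊥-^ˡ ρ u⊥v)) u-divides v-divides) A-divides)
        where
        u-divides : u ^ ρ ∣ W ^ suc ρ * E ^ ρ
        u-divides = ramification ρ {k = ∂ v} {l = v} {m = 1#} S.factors S.f₀∣E∂f₀ (proj₂ (u₁-power S))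
          (∣1⇒⊥ ∣-refl) (trans (+-cong (*-comm _ _) (*-identityˡ W)) (trans W-def (*-comm _ _)))
          where
          S = strip E u u≉0
          module S = Strip S
        v-divides : v ^ ρ ∣ W ^ suc ρ * E ^ ρ
        v-divides = ramification ρ {k = ∂ u} {l = u} {m = - 1#} S.factors S.f₀∣E∂f₀ (proj₂ (v₁-power S))
          (∣1⇒⊥ (- 1# , trans (-1*x≈-x (- 1#)) (-‿involutive 1#)))
          (begin
            ∂ u * v + - 1# * W        ≈⟨ +-cong (sym W-def) (-1*x≈-x W) ⟩
            u * ∂ v + W + - W         ≈⟨ trans (+-assoc _ W _) (trans (+-congˡ (-‿inverseʳ W)) (+-identityʳ _)) ⟩
            u * ∂ v                   ∎)
          where
          S = strip E v v≉0
          module S = Strip S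
        A-divides : A ^ ρ ∣ W ^ suc ρ * E ^ ρ
        A-divides = ramification ρ {k = suc σ ×ℕ 1# * ∂ v} {l = v} {m = suc σ ×ℕ 1# * u ^ σ} S.factors S.f₀∣E∂f₀ (proj₂ (A₁-power A≉0 S))
          (⊥-*ʳ (∣1⇒⊥ s∣1) (⊥-^ʳ σ (⊥-sym u⊥A))) (wronskian-powers σ W-def)
          where
          S = strip E A A≉0
          module S = Strip S

      height-separable : ∀ {a b e} → Deg u a → Deg v b → Deg W e →
                         (a ℕ.⊔ b) ℕ.* (ρ ℕ.* suc σ) < 2 ℕ.* (a ℕ.⊔ b) ℕ.+ ρ ℕ.* suc μ
      height-separable {a} {b} {e} u≐a v≐b W≐e = with-degree (≉0⇒degree A A≉0)
        where
        E≐ : Deg E (1 ℕ.+ suc μ)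
        E≐ = deg-* deg-X D≐
        A≤ : DegLe (coeff A) (suc σ ℕ.* (a ℕ.⊔ b))
        A≤ = degLe-+ {uˢ} {vˢ} (degLe-^ u (suc σ) (degLe-weaken {u} (ℕ.m≤m⊔n a b) (degLe u≐a)))
          (degLe-^ v (suc σ) (degLe-weaken {v} (ℕ.m≤n⊔m a b) (degLe v≐b)))
        with-degree : ∃ (Deg A) → (a ℕ.⊔ b) ℕ.* (ρ ℕ.* suc σ) < 2 ℕ.* (a ℕ.⊔ b) ℕ.+ ρ ℕ.* suc μ
        with-degree (k , A≐k) = Sum.[ u-larger , v-larger ]′ (ℕ.≤-total b a)
          where
          ramification≤ : ρ ℕ.* (a ℕ.+ b ℕ.+ k) ≤ suc ρ ℕ.* e ℕ.+ ρ ℕ.* suc (suc μ)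
          ramification≤ = ∣⇒deg≤ ramification-divides
            (deg-^ ρ (deg-* (deg-* u≐a v≐b) A≐k)) (deg-* (deg-^ (suc ρ) W≐e) (deg-^ ρ E≐))
          k≤ : k ≤ suc σ ℕ.* (a ℕ.⊔ b)
          k≤ = deg-minimal A≐k A≤
          u-larger : b ≤ a → (a ℕ.⊔ b) ℕ.* (ρ ℕ.* suc σ) < 2 ℕ.* (a ℕ.⊔ b) ℕ.+ ρ ℕ.* suc μ
          u-larger b≤a = ≡.subst (λ δ → δ ℕ.* (ρ ℕ.* suc σ) < 2 ℕ.* δ ℕ.+ ρ ℕ.* suc μ) (≡.sym (ℕ.m≥n⇒m⊔n≡m b≤a))
            (height-arithmetic ρ σ μ b≤a (wronskian-degree σ k s∣1 W-def u≐a v≐b W≐e A≐k)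
              (≡.subst (λ δ → k ≤ suc σ ℕ.* δ) (ℕ.m≥n⇒m⊔n≡m b≤a) k≤) ramification≤)
          v-larger : a ≤ b → (a ℕ.⊔ b) ℕ.* (ρ ℕ.* suc σ) < 2 ℕ.* (a ℕ.⊔ b) ℕ.+ ρ ℕ.* suc μ
          -- Exchanging `u` and `v` only reorders the sum `A` and replaces `W` by `- W`, of the same
          -- degree.
          v-larger a≤b = ≡.subst (λ δ → δ ℕ.* (ρ ℕ.* suc σ) < 2 ℕ.* δ ℕ.+ ρ ℕ.* suc μ) (≡.sym (ℕ.m≤n⇒m⊔n≡n a≤b))
            (height-arithmetic ρ σ μ a≤b
              (wronskian-degree σ k s∣1 -W-def v≐b u≐a (deg-neg W≐e) (deg-cong (+-comm uˢ vˢ) A≐k))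
              (≡.subst (λ δ → k ≤ suc σ ℕ.* δ) (ℕ.m≤n⇒m⊔n≡n a≤b) k≤)
              (≡.subst (λ n → ρ ℕ.* (n ℕ.+ k) ≤ suc ρ ℕ.* e ℕ.+ ρ ℕ.* suc (suc μ)) (ℕ.+-comm a b) ramification≤))
            where
            -W-def : v * ∂ u + - W ≈ ∂ v * u
            -W-def = begin
              v * ∂ u + - W             ≈⟨ +-congʳ (trans (*-comm v (∂ u)) (sym W-def)) ⟩
              u * ∂ v + W + - W         ≈⟨ trans (+-assoc _ W _) (trans (+-congˡ (-‿inverseʳ W)) (+-identityʳ _)) ⟩
              u * ∂ v                   ≈⟨ *-comm u (∂ v) ⟩
              ∂ v * u                   ∎

    -- When x is a p-th power, B has no multiple zero outside t = 0; but the
    -- equation forces multiplicity at least r away from the zeros of E.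
    B∣Dtᵐ : ∀ n → ρ ≡ suc n → (suc μ ×ℕ 1#) ∣ 1# → ∂ u ≈ 0# → ∂ v ≈ 0# → ¬ (B ≈ 0#) → B ∣ D * tᵐ
    B∣Dtᵐ n ≡.refl m∣1 ∂u≈0 ∂v≈0 B≉0 =
      ⊥-gauss B⊥mvˢ
        (∣-respʳ (begin
          E * ∂ B                  ≈⟨ solve 3 (λ x d b → x :* d :* b := d :* (x :* b)) refl X D (∂ B) ⟩
          D * (X * ∂ B)            ≈⟨ *-congˡ X∂B ⟩
          D * (m * (tᵐ * vˢ))
            ≈⟨ solve 4 (λ d m t v → d :* (m :* (t :* v)) := (m :* v) :* (d :* t)) refl D m tᵐ vˢ ⟩
          m * vˢ * (D * tᵐ)        ∎) B∣E∂B)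
      where
      m : Polynomial
      m = suc μ ×ℕ 1#
      B⊥mvˢ : B ⊥ m * vˢ
      B⊥mvˢ = ⊥-*ʳ (∣1⇒⊥ m∣1) (⊥-^ʳ (suc σ) (⊥-sym v⊥B))
      X∂B : X * ∂ B ≈ m * (tᵐ * vˢ)
      X∂B = begin
        X * ∂ (uˢ + tᵐ * vˢ)
          ≈⟨ *-congˡ (trans (∂-+ uˢ (tᵐ * vˢ)) (trans (+-congʳ (∂-^-zero (suc σ) ∂u≈0)) (+-identityˡ _))) ⟩
        X * ∂ (tᵐ * vˢ)
          ≈⟨ *-congˡ (trans (∂-* tᵐ vˢ) (trans (+-congˡ (trans (*-congˡ (∂-^-zero (suc σ) ∂v≈0)) (zeroʳ tᵐ))) (+-identityʳ _))) ⟩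
        X * (∂ tᵐ * vˢ)
          ≈⟨ *-congˡ (*-congʳ (trans (∂-^′ X μ) (*-congˡ (trans (*-congˡ ∂-X) (*-identityʳ _))))) ⟩
        X * (m * X ^ μ * vˢ)
          ≈⟨ solve 4 (λ x m t v → x :* (m :* t :* v) := m :* (x :* t :* v)) refl X m (X ^ μ) vˢ ⟩
        m * (tᵐ * vˢ) ∎
      S = strip E B B≉0
      open Strip S
      β : Polynomial
      β = proj₁ (B₁-power B≉0 S)
      βʳ∣f₁ : β ^ suc ρ ∣ f₁
      βʳ∣f₁ = proj₂ (proj₂ (B₁-power B≉0 S))
      β∣f₁ : β ∣ f₁
      β∣f₁ = ∣-trans (x∣xy β (β ^ suc n)) βʳ∣f₁
      β∣∂B : β ∣ ∂ B
      -- The exponent r is `n + 2`, so `β` divides `B` at least twice and survives one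
      -- differentiation. Yet t times the derivative of `B` is `m tᵐ vˢ`, coprime to `β`; hence `β`
      -- is a unit.
      β∣∂B = ∣-trans (x∣xy β (β ^ n)) (^∣⇒^∣δ ρ (∣-trans βʳ∣f₁ (f₁∣f S)))
      β⊥X∂B : β ⊥ X * ∂ B
      β⊥X∂B = ⊥-∣ʳ (1# , trans (*-identityˡ _) X∂B)
        (⊥-*ʳ (∣1⇒⊥ m∣1) (⊥-*ʳ (⊥-^ʳ (suc μ) (⊥-∣ˡ β∣f₁ (⊥E⇒⊥X f₁⊥E)))
          (⊥-^ʳ (suc σ) (⊥-∣ˡ (∣-trans β∣f₁ (f₁∣f S)) (⊥-sym v⊥B)))))
      β∣1 : β ∣ 1#
      β∣1 = ⊥-gauss β⊥X∂B (∣-respʳ (sym (*-identityʳ _)) (∣-trans β∣∂B (x∣yx (∂ B) X)))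
      f₁∣1 : f₁ ∣ 1#
      f₁∣1 = ∣-trans (proj₁ (proj₂ (B₁-power B≉0 S))) (∣-trans (∣-^ (suc ρ) β∣1) (1ⁿ∣1 (suc ρ)))
        where
        1ⁿ∣1 : ∀ n → 1# ^ n ∣ 1#
        1ⁿ∣1 zero    = ∣-refl
        1ⁿ∣1 (suc n) = ∣-respˡ (sym (*-identityˡ _)) (1ⁿ∣1 n)
      B∣E∂B : B ∣ E * ∂ B
      -- As `f₁` is a unit, `B` agrees with `f₀` up to a unit; the product rule lemma is applied
      -- with 1 as the divisor of `f₁`.
      B∣E∂B = ∣-respʳ (*-congˡ (∂-cong factors)) (∣-respˡ factors
        (∣-trans (∙-cong-∣ ∣-refl f₁∣1)
          (∣-δ-* f₀∣E∂f₀ (f₁ , *-identityʳ f₁) (_ , *-identityʳ _))))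

    -- The terms of `B` have degrees `s a` and `s (d + b)`, which differ by the hypothesis on `a`
    -- and `b`, so the larger is the degree of `B`. It is at most the degree `2 d s` of `D * tᵐ`;
    -- cancelling s bounds both `a` and `d + b` by `2 d`.
    height-inseparable : ∀ n d {a b} → ρ ≡ suc n → suc μ ≡ d ℕ.* suc σ → (suc μ ×ℕ 1#) ∣ 1# →
                         ∂ u ≈ 0# → ∂ v ≈ 0# → Deg u a → Deg v b → ¬ (a ≡ d ℕ.+ b) → a ℕ.⊔ b ≤ 2 ℕ.* d
    height-inseparable n d {a} {b} ρ≡1+n 1+μ≡ds m∣1 ∂u≈0 ∂v≈0 u≐a v≐b a≢d+b =
      Sum.[ tᵐvˢ-larger , uˢ-larger ]′ (ℕ.≤-total (suc σ ℕ.* a) deg-tᵐvˢ)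
      where
      deg-tᵐvˢ : ℕ
      deg-tᵐvˢ = suc μ ℕ.+ suc σ ℕ.* b
      deg-tᵐvˢ≡ : deg-tᵐvˢ ≡ suc σ ℕ.* (d ℕ.+ b)
      deg-tᵐvˢ≡ = ≡.trans (≡.cong (ℕ._+ suc σ ℕ.* b) (≡.trans 1+μ≡ds (ℕ.*-comm d (suc σ))))
        (≡.sym (ℕ.*-distribˡ-+ (suc σ) d b))
      degrees-differ : ¬ (suc σ ℕ.* a ≡ deg-tᵐvˢ)
      degrees-differ eq = a≢d+b (ℕ.*-cancelˡ-≡ a (d ℕ.+ b) (suc σ) (≡.trans eq deg-tᵐvˢ≡))
      uˢ≐ : Deg uˢ (suc σ ℕ.* a)
      uˢ≐ = deg-^ (suc σ) u≐a
      tᵐvˢ≐ : Deg (tᵐ * vˢ) deg-tᵐvˢ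
      tᵐvˢ≐ = deg-* (deg-X^ (suc μ)) (deg-^ (suc σ) v≐b)
      degB≤ : ∀ {k} → Deg B k → k ≤ suc σ ℕ.* (2 ℕ.* d)
      degB≤ {k} B≐k = ≡.subst (k ≤_) (≡.trans (≡.cong₂ ℕ._+_ 1+μ≡ds 1+μ≡ds) (twice-product d (suc σ)))
        (∣⇒deg≤ (B∣Dtᵐ n ρ≡1+n m∣1 ∂u≈0 ∂v≈0 (deg⇒≉0 B≐k)) B≐k (deg-* D≐ (deg-X^ (suc μ))))
      conclude : a ≤ 2 ℕ.* d → d ℕ.+ b ≤ 2 ℕ.* d → a ℕ.⊔ b ≤ 2 ℕ.* d
      conclude a≤ d+b≤ = ℕ.⊔-lub a≤ (ℕ.≤-trans (ℕ.m≤n+m b d) d+b≤)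
      tᵐvˢ-larger : suc σ ℕ.* a ≤ deg-tᵐvˢ → a ℕ.⊔ b ≤ 2 ℕ.* d
      tᵐvˢ-larger ≤tᵐvˢ = conclude (ℕ.≤-trans a≤d+b d+b≤2d) d+b≤2d
        where
        a≤d+b : a ≤ d ℕ.+ b
        a≤d+b = ℕ.*-cancelˡ-≤ (suc σ) (≡.subst (suc σ ℕ.* a ≤_) deg-tᵐvˢ≡ ≤tᵐvˢ)
        d+b≤2d : d ℕ.+ b ≤ 2 ℕ.* d
        d+b≤2d = ℕ.*-cancelˡ-≤ (suc σ) (≡.subst (_≤ suc σ ℕ.* (2 ℕ.* d)) deg-tᵐvˢ≡
          (degB≤ (deg-cong (+-comm (tᵐ * vˢ) uˢ) (deg-+ tᵐvˢ≐ (degLe uˢ≐) (ℕ.≤∧≢⇒< ≤tᵐvˢ degrees-differ)))))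
      uˢ-larger : deg-tᵐvˢ ≤ suc σ ℕ.* a → a ℕ.⊔ b ≤ 2 ℕ.* d
      uˢ-larger tᵐvˢ≤ = conclude a≤2d (ℕ.≤-trans d+b≤a a≤2d)
        where
        d+b≤a : d ℕ.+ b ≤ a
        d+b≤a = ℕ.*-cancelˡ-≤ (suc σ) (≡.subst (_≤ suc σ ℕ.* a) deg-tᵐvˢ≡ tᵐvˢ≤)
        a≤2d : a ≤ 2 ℕ.* d
        a≤2d = ℕ.*-cancelˡ-≤ (suc σ) (degB≤ (deg-+ uˢ≐ (degLe tᵐvˢ≐)
          (ℕ.≤∧≢⇒< tᵐvˢ≤ (λ eq → degrees-differ (≡.sym eq)))))

-- From the height inequalities to the bounds on δ.

open import Data.Nat using (_*_; _^_)

separable-bound : ∀ δ g N → δ * g < 2 * δ ℕ.+ N → δ * (g ∸ 2) ≤ N ∸ 1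
separable-bound δ g N δg<2δ+N = ℕ.≤-trans (ℕ.≤-reflexive (ℕ.*-distribˡ-∸ δ g 2))
  (ℕ.m≤n+o⇒m∸n≤o (δ * g) (δ * 2) (≡.subst (λ k → δ * g ≤ k ℕ.+ (N ∸ 1)) (ℕ.*-comm 2 δ) (pred N δg<2δ+N)))
  where
  pred : ∀ N → δ * g < 2 * δ ℕ.+ N → δ * g ≤ 2 * δ ℕ.+ (N ∸ 1)
  pred zero    <N = ℕ.<⇒≤ <N
  pred (suc N) <N = ℕ.≤-pred (≡.subst (δ * g <_) (ℕ.+-suc (2 * δ) N) <N)

-- The product `2 d (g - 2)` falls short of `2 d (g - 1)` by `2 d`, which is at least 1 because d is
-- positive.
inseparable-bound : ∀ δ d g → 0 < d → 2 < g → δ ≤ 2 * d → δ * (g ∸ 2) ≤ 2 * d * (g ∸ 1) ∸ 1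
inseparable-bound δ (suc d) (suc zero) _ (s≤s ()) _
inseparable-bound δ (suc d) (suc (suc x)) _ _ δ≤2d = ℕ.≤-trans (ℕ.*-monoˡ-≤ x δ≤2d)
  (ℕ.+-monoʳ-≤ x (ℕ.*-monoʳ-≤ (d ℕ.+ suc (d ℕ.+ 0)) (ℕ.n≤1+n x)))

-- Equality in the field is decided by comparing indices in `Fin q`; degrees and Euclid's algorithm
-- depend on this.
finite⇒≈0? : ∀ {c ℓ : Level} (F : CommutativeRing c ℓ) {q} → Poly.HasCard F q →
             ∀ x → Dec (CommutativeRing._≈_ F x (CommutativeRing.0# F))
finite⇒≈0? F card x with Bijection.strictlySurjective card x | Bijection.strictlySurjective card (CommutativeRing.0# F)
... | i , i↦x | j , j↦0 with i Fin.≟ j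
...   | yes i≡j = yes (trans (sym i↦x) (trans (Bijection.cong card i≡j) j↦0))
  where open CommutativeRing F
...   | no  i≢j = no λ x≈0 → i≢j (Bijection.injective card (trans i↦x (trans x≈0 (sym j↦0))))
  where open CommutativeRing F

module Conclusion {c ℓ : Level} (F : CommutativeRing c ℓ) {p q : ℕ}
  (p-prime : Prime p) (isField : Poly.IsField F) (card : Poly.HasCard F q)
  (p≈0 : CommutativeRing._≈_ F (Poly.ℕ→R F p) (CommutativeRing.0# F))
  (n σ d′ : ℕ) where

  open Poly F
  private module K = CommutativeRing F

  ≈0? : ∀ x → Dec (x ≈ 0#)
  ≈0? = finite⇒≈0? F card

  open Polynomials F
  open Degrees F isField ≈0?
  open PthRoots F isField ≈0? p-prime p≈0
  open Characteristic polynomialRing {p} p≈0ᴾ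
    using (coprime⇒×1∣1)
  module P = CommutativeRing polynomialRing
  open Comaximality polynomialRing
  open IsBézoutDomain isBézoutDomain using (bézout)
  open PowerPart polynomialRing isBézoutDomain using (*-≉0; ^-≉0)
  open import Algebra.Properties.CommutativeSemiring.Exp P.commutativeSemiring using (^-congˡ) renaming (_^_ to _^ᴾ_)
  open import Algebra.Properties.Semiring.Divisibility P.semiring using (_∣_; _,_)
  open import Algebra.Solver.Ring.NaturalCoefficients.Default P.commutativeSemiring
    using (solve; _:+_; _:*_; _:=_)

  coeff-^ : ∀ f n → coeff (f ^ᴾ n) ≈ₚ coeff f ^ₚ n
  coeff-^ f zero    _ = K.refl
  coeff-^ f (suc n) = *ₚ-cong {coeff f} (λ _ → K.refl) (coeff-^ f n)

  +ₚ-cong : ∀ {f f′ g g′} → f ≈ₚ f′ → g ≈ₚ g′ → f +ₚ g ≈ₚ f′ +ₚ g′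
  +ₚ-cong f≈f′ g≈g′ n = K.+-cong (f≈f′ n) (g≈g′ n)

  -- The gcd is a common divisor, hence a unit, and its inverse rescales the Bézout coefficients.
  coprime⇒⊥ : ∀ {u v} → CoprimeₚTo (coeff u) (coeff v) → u ⊥ v
  coprime⇒⊥ {u} {v} u⊥v = from-gcd (bézout u v)
    where
    from-gcd : (∃ λ g → g ∣ u × g ∣ v × ∃₂ λ x y → x P.* u P.+ y P.* v P.≈ g) → u ⊥ v
    from-gcd (g , (a , ag≈u) , (b , bg≈v) , x , y , eq) =
      h P.* x , h P.* y , P.trans
        (solve 5 (λ h x y u v → h :* x :* u :+ h :* y :* v := h :* (x :* u :+ y :* v)) P.refl h x y u v)
        (P.trans (P.*-congˡ eq) (coeffwise (proj₂ (proj₂ unit))))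
      where
      unit : coeff g ∣ₚ 1ₚ
      unit = u⊥v (coeff g) (isPoly g) (coeff a , isPoly a , coeff≈ ag≈u) (coeff b , isPoly b , coeff≈ bg≈v)
      h : Polynomial
      h = mkPolynomial (proj₁ unit) (proj₁ (proj₂ unit))

  ρ : ℕ
  ρ = suc n

  s d m g : ℕ
  s = suc σ
  d = suc d′
  m = d * s
  g = ρ * s

  module Point (r⊥s : Coprime (suc ρ) s) (s⊥p : Coprime s p) (d⊥p : Coprime d p) (2<g : 2 < g)
    (u v w z : Polynomial) (v≉0 : ¬ (v P.≈ P.0#)) (z≉0 : ¬ (z P.≈ P.0#)) (u⊥v : u ⊥ v)
    (on-curve : w ^ᴾ suc ρ P.* u ^ᴾ s P.* v ^ᴾ s P.≈
       z ^ᴾ suc ρ P.* (u ^ᴾ s P.+ v ^ᴾ s) P.* (u ^ᴾ s P.+ X ^ᴾ m P.* v ^ᴾ s)) where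

    -- At `u = 0` the left side of the equation vanishes, while the right side becomes
    -- `z^r t^(ds) v^(2s)`, a product of nonzero factors.
    u≉0 : ¬ (u P.≈ P.0#)
    u≉0 u≈0 = *-≉0 (*-≉0 (^-≉0 (suc ρ) z≉0) (^-≉0 s v≉0)) (*-≉0 (deg⇒≉0 (deg-X^ m)) (^-≉0 s v≉0)) (begin
      z ^ᴾ suc ρ P.* v ^ᴾ s P.* (X ^ᴾ m P.* v ^ᴾ s)
        ≈⟨ P.*-cong (P.*-congˡ (uˢ+ _)) (uˢ+ _) ⟨
      z ^ᴾ suc ρ P.* (u ^ᴾ s P.+ v ^ᴾ s) P.* (u ^ᴾ s P.+ X ^ᴾ m P.* v ^ᴾ s)
        ≈⟨ on-curve ⟨
      w ^ᴾ suc ρ P.* u ^ᴾ s P.* v ^ᴾ s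
        ≈⟨ P.trans (P.*-congʳ (P.trans (P.*-congˡ uˢ≈0) (P.zeroʳ _))) (P.zeroˡ _) ⟩
      P.0# ∎)
      where
      open import Relation.Binary.Reasoning.Setoid P.setoid
      uˢ≈0 : u ^ᴾ s P.≈ P.0#
      uˢ≈0 = P.trans (P.*-congʳ u≈0) (P.zeroˡ _)
      uˢ+ : ∀ f → u ^ᴾ s P.+ f P.≈ f
      uˢ+ f = P.trans (P.+-congʳ uˢ≈0) (P.+-identityˡ f)

    p≢1 : ¬ (p ≡ 1)
    p≢1 p≡1 = ℕ.<⇒≢ (prime>1 p-prime) (≡.sym p≡1)

    coprime⇒∤ : ∀ {k} → Coprime k p → ¬ (p ℕ∣.∣ k)
    coprime⇒∤ k⊥p p∣k = p≢1 (k⊥p (p∣k , ℕ∣.∣-refl))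

    open import Algebra.Properties.Semiring.Mult P.semiring using () renaming (_×_ to _×ℕ_)

    s∣1 : (s ×ℕ P.1#) ∣ P.1#
    s∣1 = coprime⇒×1∣1 s⊥p

    m∣1 : (m ×ℕ P.1#) ∣ P.1#
    m∣1 = coprime⇒×1∣1 (∤⇒coprime λ p∣ds →
      Sum.[ coprime⇒∤ d⊥p , coprime⇒∤ s⊥p ]′ (euclidsLemma d s p-prime p∣ds))

    open Curve F isField ≈0?

    u≐ : ∃ (Deg u)
    u≐ = ≉0⇒degree u u≉0
    v≐ : ∃ (Deg v)
    v≐ = ≉0⇒degree v v≉0

    δ : ℕ
    δ = proj₁ u≐ ℕ.⊔ proj₁ v≐

    u≤δ : DegLe (coeff u) δ
    u≤δ = degLe-weaken {u} (ℕ.m≤m⊔n _ _) (degLe (proj₂ u≐))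

    v≤δ : DegLe (coeff v) δ
    v≤δ = degLe-weaken {v} (ℕ.m≤n⊔m (proj₁ u≐) _) (degLe (proj₂ v≐))

    derivatives≈0⇒pth-power : ∂ u P.≈ P.0# → ∂ v P.≈ P.0# → IsPthPowerFrac p (coeff u) (coeff v)
    derivatives≈0⇒pth-power ∂u≈0 ∂v≈0 = coeff a , coeff b , isPoly a , isPoly b ,
      (λ b≈0 → v≉0 (P.trans (P.sym bᵖ≈v) (P.trans (^-congˡ p (coeffwise b≈0)) 0^p≈0))) ,
      λ i → K.trans (*ₚ-cong {coeff u} (λ _ → K.refl) (λ j → K.sym (coeff-^ b p j)) i)
        (K.trans (coeff≈ ubᵖ≈vaᵖ i) (*ₚ-cong {coeff v} (λ _ → K.refl) (coeff-^ a p) i))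
      where
      a b : Polynomial
      a = proj₁ (pth-root card u (∂≈0⇒coeff≈0 ∂u≈0))
      b = proj₁ (pth-root card v (∂≈0⇒coeff≈0 ∂v≈0))
      aᵖ≈u : a ^ᴾ p P.≈ u
      aᵖ≈u = proj₂ (pth-root card u (∂≈0⇒coeff≈0 ∂u≈0))
      bᵖ≈v : b ^ᴾ p P.≈ v
      bᵖ≈v = proj₂ (pth-root card v (∂≈0⇒coeff≈0 ∂v≈0))
      ubᵖ≈vaᵖ : u P.* b ^ᴾ p P.≈ v P.* a ^ᴾ p
      ubᵖ≈vaᵖ = P.trans (P.*-congˡ bᵖ≈v) (P.trans (P.*-comm u v) (P.*-congˡ (P.sym aᵖ≈u)))

    separable : ¬ IsPthPowerFrac p (coeff u) (coeff v) → δ * (g ∸ 2) ≤ d * g ∸ 1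
    separable not-pth-power = separable-bound δ g (d * g)
      (≡.subst (λ N → δ * g < 2 * δ ℕ.+ N) (swap-factors ρ d s) (by-degree (degree W)))
      where
      W : Polynomial
      W = ∂ u P.* v P.+ P.- (u P.* ∂ v)
      W-def : u P.* ∂ v P.+ W P.≈ ∂ u P.* v
      W-def = P.trans (solve 3 (λ a b c → a :+ (b :+ c) := b :+ (a :+ c)) P.refl (u P.* ∂ v) (∂ u P.* v) (P.- (u P.* ∂ v)))
        (P.trans (P.+-congˡ (P.-‿inverseʳ _)) (P.+-identityʳ _))
      swap-factors : ∀ a b c → a * (b * c) ≡ b * (a * c)
      swap-factors a b c = ≡.trans (≡.sym (ℕ.*-assoc a b c)) (≡.trans (≡.cong (_* c) (ℕ.*-comm a b)) (ℕ.*-assoc b a c))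
      by-degree : W P.≈ P.0# ⊎ ∃ (Deg W) → δ * g < 2 * δ ℕ.+ ρ * m
      by-degree (inj₁ W≈0) = ⊥-elim (not-pth-power (derivatives≈0⇒pth-power (proj₁ ∂≈0) (proj₂ ∂≈0)))
        where
        ∂≈0 : ∂ u P.≈ P.0# × ∂ v P.≈ P.0#
        ∂≈0 = wronskian≈0⇒∂≈0 u⊥v (P.trans (P.sym (P.trans (P.+-congˡ W≈0) (P.+-identityʳ _))) W-def)
      -- `σ + d′ * s` is `d * s - 1`, written so that its successor computes to `d * s`.
      by-degree (inj₂ (e , W≐e)) = height-separable ρ σ (σ ℕ.+ d′ * s) r⊥s s∣1 v≉0 z≉0 u≉0 u⊥v on-curve
        W-def (deg⇒≉0 W≐e) (proj₂ u≐) (proj₂ v≐) W≐e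

    inseparable : IsPthPowerFrac p (coeff u) (coeff v) → δ * (g ∸ 2) ≤ 2 * d * (g ∸ 1) ∸ 1
    inseparable (a , b , a-poly , b-poly , b≉0 , ubᵖ≈vaᵖ) = inseparable-bound δ d g (s≤s z≤n) 2<g
      (height-inseparable ρ σ (σ ℕ.+ d′ * s) r⊥s s∣1 v≉0 z≉0 u≉0 u⊥v on-curve n d ≡.refl ≡.refl m∣1
        (proj₁ ∂≈0) (proj₂ ∂≈0) (proj₂ u≐) (proj₂ v≐) degrees-differ)
      where
      a′ b′ : Polynomial
      a′ = mkPolynomial a a-poly
      b′ = mkPolynomial b b-poly
      ∂≈0 : ∂ u P.≈ P.0# × ∂ v P.≈ P.0#
      ∂≈0 = wronskian≈0⇒∂≈0 u⊥v (pth-power⇒wronskian≈0 {u} {v} {a′} {b′} (λ b≈0 → b≉0 (coeff≈ b≈0)) (coeffwise λ i →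
        K.trans (*ₚ-cong {coeff u} (λ _ → K.refl) (coeff-^ b′ p) i)
          (K.trans (ubᵖ≈vaᵖ i) (*ₚ-cong {coeff v} (λ _ → K.refl) (λ j → K.sym (coeff-^ a′ p j)) i))))
      degrees-differ : ¬ (proj₁ u≐ ≡ d ℕ.+ proj₁ v≐)
      degrees-differ eq = coprime⇒∤ d⊥p (ℕ∣.∣m+n∣m⇒∣n
        (≡.subst (p ℕ∣.∣_) (≡.trans eq (ℕ.+-comm d (proj₁ v≐))) (∂≈0⇒p∣deg (proj₁ ∂≈0) (proj₂ u≐)))
        (∂≈0⇒p∣deg (proj₂ ∂≈0) (proj₂ v≐)))

-- The equation is that of the curve at x = u/v, y = w/z with denominators cleared. A `δ` bounding
-- both degrees carries the same information as their maximum, since the final inequality is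
-- inherited by smaller values.
mainTheorem5 : ∀ {c ℓ : Level} (F : CommutativeRing c ℓ) → let open Poly F in
    (p q : ℕ) → Prime p → (∃ λ k → q ≡ p ^ k) →
    IsField → HasCard q → ℕ→R p ≈ 0# →
    (r s d : ℕ) → 0 < r → 0 < s → 0 < d →
    Coprime r s → Coprime r p → Coprime s p → Coprime d p →
    (g : ℕ) → g ≡ (r ∸ 1) * s → 2 < g →
    (u v w z : Seq) → IsPoly u → IsPoly v → IsPoly w → IsPoly z →
    ¬ (v ≈ₚ 0ₚ) → ¬ (z ≈ₚ 0ₚ) → CoprimeₚTo u v →
    (w ^ₚ r) *ₚ (u ^ₚ s) *ₚ (v ^ₚ s)
    ≈ₚ (z ^ₚ r) *ₚ ((u ^ₚ s) +ₚ (v ^ₚ s)) *ₚ ((u ^ₚ s) +ₚ tpow (d * s) *ₚ (v ^ₚ s)) →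
    (¬ IsPthPowerFrac p u v →
    ∃ λ δ → DegLe u δ × DegLe v δ × δ * (g ∸ 2) ≤ d * g ∸ 1)
    × (IsPthPowerFrac p u v →
    ∃ λ δ → DegLe u δ × DegLe v δ × δ * (g ∸ 2) ≤ 2 * d * (g ∸ 1) ∸ 1)
-- For r = 1 the genus is 0, against `2 < g`; so r is at least 2 from here on.
mainTheorem5 F p q p-prime _ isField card p≈0 (suc zero) s d _ _ _ _ _ _ _ g ≡.refl ()
mainTheorem5 F p q p-prime _ isField card p≈0 (suc (suc n)) (suc σ) (suc d′) _ _ _ r⊥s _ s⊥p d⊥p g ≡.refl 2<g
             u v w z u-poly v-poly w-poly z-poly v≉0 z≉0 u⊥v on-curve =
  (λ not-pth-power → C.δ , C.u≤δ , C.v≤δ , C.separable not-pth-power) ,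
  (λ pth-power → C.δ , C.u≤δ , C.v≤δ , C.inseparable pth-power)
  where
  open Poly F using (_≈ₚ_; _*ₚ_; _+ₚ_; _^ₚ_; tpow)
  open Conclusion F p-prime isField card p≈0 n σ d′ using (coprime⇒⊥; coeff-^; +ₚ-cong)
  open Polynomials F using (Polynomial; mkPolynomial; coeffwise; coeff≈; coeff; *ₚ-cong; polynomialRing)
  open Degrees F isField (finite⇒≈0? F card) using (X; X^≈tpow)
  module P = CommutativeRing polynomialRing
  module K = CommutativeRing F
  open import Algebra.Properties.CommutativeSemiring.Exp P.commutativeSemiring using () renaming (_^_ to _^ᴾ_)
  U V W Z : Polynomial
  U = mkPolynomial u u-poly
  V = mkPolynomial v v-poly
  W = mkPolynomial w w-poly
  Z = mkPolynomial z z-poly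
  r s m : ℕ
  r = suc (suc n)
  s = suc σ
  m = suc d′ * s
  left : coeff (W ^ᴾ r P.* U ^ᴾ s P.* V ^ᴾ s) ≈ₚ w ^ₚ r *ₚ u ^ₚ s *ₚ v ^ₚ s
  left = *ₚ-cong (*ₚ-cong (coeff-^ W r) (coeff-^ U s)) (coeff-^ V s)
  right : coeff (Z ^ᴾ r P.* (U ^ᴾ s P.+ V ^ᴾ s) P.* (U ^ᴾ s P.+ X ^ᴾ m P.* V ^ᴾ s)) ≈ₚ
          z ^ₚ r *ₚ (u ^ₚ s +ₚ v ^ₚ s) *ₚ (u ^ₚ s +ₚ tpow m *ₚ v ^ₚ s)
  right = *ₚ-cong (*ₚ-cong (coeff-^ Z r) (+ₚ-cong (coeff-^ U s) (coeff-^ V s)))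
    (+ₚ-cong (coeff-^ U s) (*ₚ-cong (X^≈tpow m) (coeff-^ V s)))
  on-curveᴾ : W ^ᴾ r P.* U ^ᴾ s P.* V ^ᴾ s P.≈ Z ^ᴾ r P.* (U ^ᴾ s P.+ V ^ᴾ s) P.* (U ^ᴾ s P.+ X ^ᴾ m P.* V ^ᴾ s)
  on-curveᴾ = coeffwise λ i → K.trans (left i) (K.trans (on-curve i) (K.sym (right i)))
  V≉0 : ¬ (V P.≈ P.0#)
  V≉0 V≈0 = v≉0 (coeff≈ V≈0)
  Z≉0 : ¬ (Z P.≈ P.0#)
  Z≉0 Z≈0 = z≉0 (coeff≈ Z≈0)
  module C = Conclusion.Point F p-prime isField card p≈0 n σ d′ r⊥s s⊥p d⊥p 2<g U V W Z
    V≉0 Z≉0 (coprime⇒⊥ u⊥v) on-curveᴾ
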